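{- Over $\mathrm{ZFU}_{\mathrm{R}}$: (1) Tail$^+$ implies (every instance of) RP; (2) Plenitude$^+$ implies Duplication.
   Context: The language of urelement set theory has $\in$ and a unary predicate $\mathcal{A}$ for urelements. $\mathrm{ZFU}_{\mathrm{R}}$ = ZU (urelements have no members, Extensionality for sets, Foundation, Pairing, Union, Powerset, Infinity, Separation scheme) + Replacement scheme; no choice is assumed. For a set $A$ of urelements, a tail of $A$ is a set $B$ of urelements disjoint from $A$ such that every set of urelements disjoint from $A$ injects into $B$. Tail$^+$: every set of urelements has a well-orderable tail. Plenitude$^+$: every set is equinumerous with some set of urelements. Duplication: every set $A$ of urelements has a duplicate, i.e. a set of urelements disjoint from $A$ and equinumerous with it. RP (scheme): for each formula $\varphi$, for every set $x$ there is a transitive set $t\supseteq x$ such that for all $x_1,\dots,x_n\in t$, $\varphi(x_1,\dots,x_n)\leftrightarrow\varphi^t(x_1,\dots,x_n)$. -}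

module Defs where

open import Data.Nat using (ℕ; zero; suc)
open import Data.Fin using (Fin; zero; suc)
open import Data.Product using (Σ; _×_; _,_; ∃)
open import Data.Sum using (_⊎_)
open import Data.Empty using (⊥)
open import Relation.Nullary using (¬_)
open import Relation.Binary.PropositionalEquality using (_≡_)
open import Function.Bundles using (_⇔_)

-- Structures for the language {∈, 𝒜} (equality is interpreted as ≡)

record Structure : Set₁ where
  field
    U   : Set
    _∈_ : U → U → Set
    𝒜   : U → Set

-- First-order formulas with de Bruijn variables; n = number of free vars

data Formula : ℕ → Set where
  mem  : ∀ {n} → Fin n → Fin n → Formula n
  ur   : ∀ {n} → Fin n → Formula n
  eq   : ∀ {n} → Fin n → Fin n → Formula n
  fls  : ∀ {n} → Formula n
  _⇒_  : ∀ {n} → Formula n → Formula n → Formula n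
  all  : ∀ {n} → Formula (suc n) → Formula n

module _ (M : Structure) where
  open Structure M

  ext : ∀ {n} → U → (Fin n → U) → Fin (suc n) → U
  ext u ρ zero    = u
  ext u ρ (suc i) = ρ i

  -- Tarskian satisfaction (classical when excluded middle is assumed)
  Sat : ∀ {n} → Formula n → (Fin n → U) → Set
  Sat (mem i j) ρ = ρ i ∈ ρ j
  Sat (ur i)    ρ = 𝒜 (ρ i)
  Sat (eq i j)  ρ = ρ i ≡ ρ j
  Sat fls       ρ = ⊥
  Sat (φ ⇒ ψ)   ρ = Sat φ ρ → Sat ψ ρ
  Sat (all φ)   ρ = (u : U) → Sat φ (ext u ρ)

  SatRel : U → ∀ {n} → Formula n → (Fin n → U) → Set
  SatRel t (mem i j) ρ = ρ i ∈ ρ j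
  SatRel t (ur i)    ρ = 𝒜 (ρ i)
  SatRel t (eq i j)  ρ = ρ i ≡ ρ j
  SatRel t fls       ρ = ⊥
  SatRel t (φ ⇒ ψ)   ρ = SatRel t φ ρ → SatRel t ψ ρ
  SatRel t (all φ)   ρ = (u : U) → u ∈ t → SatRel t φ (ext u ρ)

  IsSet : U → Set
  IsSet x = ¬ 𝒜 x

  IsEmptySet : U → Set
  IsEmptySet e = IsSet e × (∀ z → ¬ (z ∈ e))

  _⊆_ : U → U → Set
  x ⊆ y = ∀ z → z ∈ x → z ∈ y

  IsUrSet : U → Set
  IsUrSet a = IsSet a × (∀ y → y ∈ a → 𝒜 y)

  Disjoint : U → U → Set
  Disjoint a b = ∀ z → z ∈ a → ¬ (z ∈ b)

  Transitive : U → Set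
  Transitive t = IsSet t × (∀ y z → y ∈ t → z ∈ y → z ∈ t)

  IsUPair : U → U → U → Set
  IsUPair p x y = IsSet p × (∀ z → (z ∈ p) ⇔ (z ≡ x ⊎ z ≡ y))

  IsOPair : U → U → U → Set
  IsOPair p x y = Σ U λ s → Σ U λ t → IsUPair s x x × IsUPair t x y × IsUPair p s t

  Rel : U → U → U → Set
  Rel r x y = Σ U λ p → p ∈ r × IsOPair p x y

  IsRelOn : U → U → U → Set
  IsRelOn r a b = IsSet r × (∀ p → p ∈ r → Σ U λ x → Σ U λ y → x ∈ a × y ∈ b × IsOPair p x y)

  IsInjection : U → U → U → Set
  IsInjection f a b =
    IsRelOn f a b ×
    (∀ x → x ∈ a → Σ U λ y → Rel f x y) ×
    (∀ x y y' → Rel f x y → Rel f x y' → y ≡ y') ×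
    (∀ x x' y → Rel f x y → Rel f x' y → x ≡ x')

  Injects : U → U → Set
  Injects a b = Σ U λ f → IsInjection f a b

  Equinumerous : U → U → Set
  Equinumerous a b = Σ U λ f → IsInjection f a b × (∀ y → y ∈ b → Σ U λ x → Rel f x y)

  IsWellOrder : U → U → Set
  IsWellOrder r a =
    IsRelOn r a a ×
    (∀ x → x ∈ a → ¬ Rel r x x) ×
    (∀ x y z → x ∈ a → y ∈ a → z ∈ a → Rel r x y → Rel r y z → Rel r x z) ×
    (∀ x y → x ∈ a → y ∈ a → Rel r x y ⊎ (x ≡ y ⊎ Rel r y x)) ×
    (∀ s → IsSet s → s ⊆ a → (Σ U λ z → z ∈ s) →
       Σ U λ m → m ∈ s × (∀ z → z ∈ s → ¬ Rel r z m))

  WellOrderable : U → Set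
  WellOrderable a = Σ U λ r → IsWellOrder r a

  ZFUR : Set
  ZFUR =
    (∀ a → 𝒜 a → ∀ z → ¬ (z ∈ a)) ×
    (∀ x y → IsSet x → IsSet y → (∀ z → (z ∈ x) ⇔ (z ∈ y)) → x ≡ y) ×
    (∀ x → (Σ U λ y → y ∈ x) → Σ U λ y → y ∈ x × (∀ z → z ∈ x → ¬ (z ∈ y))) ×
    (∀ x y → Σ U λ p → IsSet p × x ∈ p × y ∈ p) ×
    (∀ x → Σ U λ u → IsSet u × (∀ y z → y ∈ x → z ∈ y → z ∈ u)) ×
    (∀ x → Σ U λ p → IsSet p × (∀ y → IsSet y → y ⊆ x → y ∈ p)) ×
    (Σ U λ w → IsSet w × (Σ U λ e → e ∈ w × IsEmptySet e) ×
       (∀ y → y ∈ w → Σ U λ s → s ∈ w × IsSet s × (∀ z → (z ∈ s) ⇔ (z ∈ y ⊎ z ≡ y)))) ×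
    (∀ {n} (φ : Formula (suc n)) (ρ : Fin n → U) (x : U) →
       Σ U λ y → IsSet y × (∀ z → (z ∈ y) ⇔ (z ∈ x × Sat φ (ext z ρ)))) ×
    -- Replacement scheme (φ(u, v, params): var 0 = v, var 1 = u)
    (∀ {n} (φ : Formula (suc (suc n))) (ρ : Fin n → U) (x : U) →
       (∀ u → u ∈ x →
          (Σ U λ v → Sat φ (ext v (ext u ρ))) ×
          (∀ v v' → Sat φ (ext v (ext u ρ)) → Sat φ (ext v' (ext u ρ)) → v ≡ v')) →
       Σ U λ y → IsSet y × (∀ u → u ∈ x → Σ U λ v → v ∈ y × Sat φ (ext v (ext u ρ))))

  IsTail : U → U → Set
  IsTail a b = IsUrSet b × Disjoint a b ×
               (∀ c → IsUrSet c → Disjoint c a → Injects c b)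

  TailPlus : Set
  TailPlus = ∀ a → IsUrSet a → Σ U λ b → IsTail a b × WellOrderable b

  PlenitudePlus : Set
  PlenitudePlus = ∀ x → IsSet x → Σ U λ a → IsUrSet a × Equinumerous x a

  Duplication : Set
  Duplication = ∀ a → IsUrSet a → Σ U λ b → IsUrSet b × Disjoint a b × Equinumerous a b

  RP : Set
  RP = ∀ {n} (φ : Formula n) (x : U) → IsSet x →
       Σ U λ t → Transitive t × x ⊆ t ×
         (∀ (ρ : Fin n → U) → (∀ i → ρ i ∈ t) → Sat φ ρ ⇔ SatRel t φ ρ)

{-# OPTIONS --safe #-}
-- Duplication: given an injection of A × 𝒫 A into a set of urelements, Cantor's diagonal argument
-- picks, uniformly in x ∈ A, a subset D x of A such that (x , D x) is sent outside A.
--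
-- Reflection: since cardinals of well-orderable sets are well-founded, every set of urelements
-- extends to a K with a tail B that injects into every tail of every larger set. Then B absorbs
-- two copies of itself, which yields an increasing sequence K = A₀ ⊆ A₁ ⊆ … of sets of urelements,
-- each leaving room for a copy of B in the next. If a statement with parameters supported by Aₙ
-- has a witness u, then two successive exchanges of urelements, each fixing Aₙ pointwise, first
-- displace the remaining urelements of u into a remote tail and then into Aₙ₊₁; so the sets
-- supported by some Aₙ form an elementary substructure. That class is exhausted by the cumulative
-- hierarchy over the set ⋃ Aₙ, and closing under least stages containing counterexamples gives
-- the reflecting set, as in the classical Lévy–Montague argument.
module Submission where

open import Defs
open import Level using (0ℓ)
open import Data.Nat using (ℕ; zero; suc; _+_)
open import Data.Fin using (Fin; zero; suc; _↑ˡ_; _↑ʳ_; splitAt)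
open import Data.Fin.Properties using (splitAt-↑ˡ; splitAt-↑ʳ)
open import Data.Product using (Σ; _×_; _,_; proj₁; proj₂)
open import Data.Sum using (_⊎_; inj₁; inj₂; [_,_]′)
open import Data.Empty using (⊥; ⊥-elim)
open import Relation.Nullary using (¬_; Dec; yes; no)
open import Relation.Binary.PropositionalEquality
  using (_≡_; refl; sym; trans; cong; cong₂; subst; subst₂)
open import Function.Base using (_$_; case_of_)
open import Function.Bundles using (_⇔_; mk⇔; Equivalence)
open import Axiom.ExcludedMiddle using (ExcludedMiddle)

open Equivalence using (to; from)

-- The urelements may form a proper class. No hierarchy over a set of urelements then exhausts the
-- universe, and Replacement alone gives no bound on where witnesses of an existential statement
-- occur. This blocks the usual reflection argument, so the universe is first cut down to a class
-- whose members draw their urelements from one set. Each witness may consume as many new urelements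
-- as `B` has, so free room must be renewed at every step; hence an increasing sequence of sets of
-- urelements rather than a single one. Choice is avoided throughout: chosen witnesses are replaced
-- by whole least stages, and cardinals are compared only through initial segments of one
-- well-ordered tail. Separation and Replacement speak about formulas only, so every class or
-- function that enters the formation of a set carries a definition by a formula with parameters.

⇔-trans : {A B C : Set} → A ⇔ B → B ⇔ C → A ⇔ C
⇔-trans f g = mk⇔ (λ a → to g (to f a)) (λ c → from f (from g c))

⇔-sym : {A B : Set} → A ⇔ B → B ⇔ A
⇔-sym f = mk⇔ (from f) (to f)

-- Renaming of variables in formulas.

lift : ∀ {m n} → (Fin m → Fin n) → Fin (suc m) → Fin (suc n)
lift f zero    = zero
lift f (suc i) = suc (f i)

rename : ∀ {m n} → (Fin m → Fin n) → Formula m → Formula n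
rename f (mem i j) = mem (f i) (f j)
rename f (ur i)    = ur (f i)
rename f (eq i j)  = eq (f i) (f j)
rename f fls       = fls
rename f (φ ⇒ ψ)   = rename f φ ⇒ rename f ψ
rename f (all φ)   = all (rename (lift f) φ)

module Satisfaction (M : Structure) where
  open Structure M

  Env : ℕ → Set
  Env n = Fin n → U

  Sat-cong : ∀ {n} (φ : Formula n) {ρ ρ' : Env n} → (∀ i → ρ i ≡ ρ' i) → Sat M φ ρ → Sat M φ ρ'
  Sat-cong (mem i j) e s = subst₂ _∈_ (e i) (e j) s
  Sat-cong (ur i)    e s = subst 𝒜 (e i) s
  Sat-cong (eq i j)  e s = trans (sym (e i)) (trans s (e j))
  Sat-cong fls       e s = s
  Sat-cong (φ ⇒ ψ)   e s = λ p → Sat-cong ψ e (s (Sat-cong φ (λ i → sym (e i)) p))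
  Sat-cong (all φ)   e s = λ u → Sat-cong φ (λ { zero → refl ; (suc i) → e i }) (s u)

  Sat-rename : ∀ {m n} (φ : Formula m) (f : Fin m → Fin n) {ρ : Env n} →
               Sat M (rename f φ) ρ ⇔ Sat M φ (λ i → ρ (f i))
  Sat-rename (mem i j) f = mk⇔ (λ s → s) (λ s → s)
  Sat-rename (ur i)    f = mk⇔ (λ s → s) (λ s → s)
  Sat-rename (eq i j)  f = mk⇔ (λ s → s) (λ s → s)
  Sat-rename fls       f = mk⇔ (λ s → s) (λ s → s)
  Sat-rename (φ ⇒ ψ)   f = mk⇔
    (λ s p → to (Sat-rename ψ f) (s (from (Sat-rename φ f) p)))
    (λ s p → from (Sat-rename ψ f) (s (to (Sat-rename φ f) p)))
  Sat-rename (all φ)   f = mk⇔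
    (λ s u → Sat-cong φ (λ { zero → refl ; (suc i) → refl }) (to (Sat-rename φ (lift f)) (s u)))
    (λ s u → from (Sat-rename φ (lift f)) (Sat-cong φ (λ { zero → refl ; (suc i) → refl }) (s u)))

-- Classes and functions definable with parameters.

module Definability (em : ExcludedMiddle 0ℓ) (M : Structure) (u₀ : Structure.U M) where
  open Structure M
  open Satisfaction M

  dne : {P : Set} → ¬ ¬ P → P
  dne {P} h with em {P}
  ... | yes p = p
  ... | no np = ⊥-elim (h np)

  Ref : ℕ → Set
  Ref n = Fin n ⊎ U

  ⟦_⟧ : ∀ {n} → Ref n → Env n → U
  ⟦ inj₁ i ⟧ ρ = ρ i
  ⟦ inj₂ a ⟧ ρ = a

  -- First-order definability with parameters: a formula in m variables together with an
  -- assignment of each of them to a coordinate of the environment or to a parameter.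
  record Def {n} (P : Env n → Set) : Set where
    constructor mkDef
    field
      {arity} : ℕ
      refs    : Fin arity → Ref n
      formula : Formula arity
      correct : ∀ ρ → Sat M formula (λ i → ⟦ refs i ⟧ ρ) ⇔ P ρ

  opaque
    d⇔ : ∀ {n} {P Q : Env n → Set} → (∀ ρ → P ρ ⇔ Q ρ) → Def P → Def Q
    d⇔ e (mkDef σ φ c) = mkDef σ φ (λ ρ → ⇔-trans (c ρ) (e ρ))

    substRef : ∀ {k n} → (Fin k → Ref n) → Ref k → Ref n
    substRef τ (inj₁ i) = τ i
    substRef τ (inj₂ a) = inj₂ a

    dref : ∀ {k n} {P : Env k → Set} → Def P → (τ : Fin k → Ref n) →
           Def (λ ρ → P (λ i → ⟦ τ i ⟧ ρ))
    dref (mkDef σ φ c) τ = mkDef (λ i → substRef τ (σ i)) φ λ ρ →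
        ⇔-trans (mk⇔ (Sat-cong φ (λ i → e ρ (σ i))) (Sat-cong φ (λ i → sym (e ρ (σ i)))))
                (c (λ i → ⟦ τ i ⟧ ρ))
      where
      e : ∀ ρ r → ⟦ substRef τ r ⟧ ρ ≡ ⟦ r ⟧ (λ i → ⟦ τ i ⟧ ρ)
      e ρ (inj₁ i) = refl
      e ρ (inj₂ a) = refl

    d⊥ : ∀ {n} → Def {n} (λ _ → ⊥)
    d⊥ = mkDef {arity = 0} (λ ()) fls (λ ρ → mk⇔ (λ x → x) (λ x → x))

    d→ : ∀ {n} {P Q : Env n → Set} → Def P → Def Q → Def (λ ρ → P ρ → Q ρ)
    d→ {n} {P} {Q} (mkDef {k} σ φ c) (mkDef {l} τ ψ d) =
      mkDef στ (rename (_↑ˡ l) φ ⇒ rename (k ↑ʳ_) ψ)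
        λ ρ → mk⇔ (λ s p → to (right ρ) (s (from (left ρ) p))) (λ s p → from (right ρ) (s (to (left ρ) p)))
      where
      στ : Fin (k + l) → Ref n
      στ i = [ σ , τ ]′ (splitAt k i)
      eˡ : ∀ ρ i → ⟦ στ (i ↑ˡ l) ⟧ ρ ≡ ⟦ σ i ⟧ ρ
      eˡ ρ i = cong (λ z → ⟦ [ σ , τ ]′ z ⟧ ρ) (splitAt-↑ˡ k i l)
      eʳ : ∀ ρ i → ⟦ στ (k ↑ʳ i) ⟧ ρ ≡ ⟦ τ i ⟧ ρ
      eʳ ρ i = cong (λ z → ⟦ [ σ , τ ]′ z ⟧ ρ) (splitAt-↑ʳ k l i)
      left : ∀ ρ → Sat M (rename (_↑ˡ l) φ) (λ i → ⟦ στ i ⟧ ρ) ⇔ P ρ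
      left ρ = ⇔-trans (Sat-rename φ _)
        (⇔-trans (mk⇔ (Sat-cong φ (eˡ ρ)) (Sat-cong φ (λ i → sym (eˡ ρ i)))) (c ρ))
      right : ∀ ρ → Sat M (rename (k ↑ʳ_) ψ) (λ i → ⟦ στ i ⟧ ρ) ⇔ Q ρ
      right ρ = ⇔-trans (Sat-rename ψ _)
        (⇔-trans (mk⇔ (Sat-cong ψ (eʳ ρ)) (Sat-cong ψ (λ i → sym (eʳ ρ i)))) (d ρ))

    -- Several slots of the formula may refer to coordinate zero. `bind` merges all of them into the
    -- quantified variable and shifts the remaining slots by one.
    d∀ : ∀ {n} {R : U → Env n → Set} → Def {suc n} (λ ρ → R (ρ zero) (λ i → ρ (suc i))) →
         Def (λ ρ → ∀ u → R u ρ)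
    d∀ {n} {R} (mkDef {k} σ φ c) = mkDef (λ i → unbind (σ i)) (all (rename (λ i → bind (σ i) i) φ))
        λ ρ → mk⇔ (λ s u → to (body ρ u) (s u)) (λ s u → from (body ρ u) (s u))
      where
      unbind : Ref (suc n) → Ref n
      -- `u₀` is only a filler: `bind` redirects every occurrence of such a slot to the quantified
      -- variable.
      unbind (inj₁ zero)    = inj₂ u₀
      unbind (inj₁ (suc i)) = inj₁ i
      unbind (inj₂ a)       = inj₂ a
      bind : Ref (suc n) → Fin k → Fin (suc k)
      bind (inj₁ zero)    i = zero
      bind (inj₁ (suc _)) i = suc i
      bind (inj₂ a)       i = suc i
      e : ∀ ρ u r i → r ≡ σ i → ext M u (λ i → ⟦ unbind (σ i) ⟧ ρ) (bind r i) ≡ ⟦ r ⟧ (ext M u ρ)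
      e ρ u (inj₁ zero)    i q = refl
      e ρ u (inj₁ (suc j)) i q = cong (λ r → ⟦ unbind r ⟧ ρ) (sym q)
      e ρ u (inj₂ a)       i q = cong (λ r → ⟦ unbind r ⟧ ρ) (sym q)
      body : ∀ ρ u → Sat M (rename (λ i → bind (σ i) i) φ) (ext M u (λ i → ⟦ unbind (σ i) ⟧ ρ)) ⇔ R u ρ
      body ρ u = ⇔-trans (Sat-rename φ _)
        (⇔-trans (mk⇔ (Sat-cong φ (λ i → e ρ u (σ i) i refl)) (Sat-cong φ (λ i → sym (e ρ u (σ i) i refl))))
                 (c (ext M u ρ)))

    d¬ : ∀ {n} {P : Env n → Set} → Def P → Def (λ ρ → ¬ P ρ)
    d¬ p = d→ p d⊥

    -- The language has only `⇒`, `fls` and `all`, so the other connectives enter through their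
    -- classical encodings, and excluded middle recovers the constructive reading from them.
    d× : ∀ {n} {P Q : Env n → Set} → Def P → Def Q → Def (λ ρ → P ρ × Q ρ)
    d× p q = d⇔ (λ ρ → mk⇔ (λ h → dne (λ k → h (λ a b → k (a , b)))) (λ { (a , b) h → h a b }))
                (d¬ (d→ p (d¬ q)))

    d⊎ : ∀ {n} {P Q : Env n → Set} → Def P → Def Q → Def (λ ρ → P ρ ⊎ Q ρ)
    d⊎ p q = d⇔ (λ ρ → mk⇔ (λ h → dne (λ k → k (inj₂ (h (λ a → k (inj₁ a))))))
                           (λ { (inj₁ a) na → ⊥-elim (na a) ; (inj₂ b) _ → b }))
                (d→ (d¬ p) q)

    d∃ : ∀ {n} {R : U → Env n → Set} → Def {suc n} (λ ρ → R (ρ zero) (λ i → ρ (suc i))) →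
         Def (λ ρ → Σ U λ u → R u ρ)
    d∃ {R = R} p = d⇔ (λ ρ → mk⇔ (λ h → dne (λ k → h (λ u r → k (u , r)))) (λ { (u , r) h → h u r }))
                (d¬ (d∀ {R = λ u ρ → ¬ R u ρ} (d¬ p)))

    d⟷ : ∀ {n} {P Q : Env n → Set} → Def P → Def Q → Def (λ ρ → P ρ ⇔ Q ρ)
    d⟷ p q = d⇔ (λ ρ → mk⇔ (λ { (f , g) → mk⇔ f g }) (λ e → to e , from e)) (d× (d→ p q) (d→ q p))

  record DefT {n} (f : Env n → U) : Set where
    constructor mkT
    field graph : Def {suc n} (λ ρ → ρ zero ≡ f (λ i → ρ (suc i)))
  open DefT

  opaque
    private
      atom₂ : ∀ {n} → Ref n → Ref n → Fin 2 → Ref n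
      atom₂ r s zero    = r
      atom₂ r s (suc _) = s

    t-ref : ∀ {n} (r : Ref n) → DefT ⟦ r ⟧
    t-ref (inj₁ i) = mkT $ mkDef (atom₂ (inj₁ zero) (inj₁ (suc i))) (eq zero (suc zero)) (λ ρ → mk⇔ (λ x → x) (λ x → x))
    t-ref (inj₂ a) = mkT $ mkDef (atom₂ (inj₁ zero) (inj₂ a)) (eq zero (suc zero)) (λ ρ → mk⇔ (λ x → x) (λ x → x))

    v : ∀ {n} {i : Fin n} → DefT (λ ρ → ρ i)
    v {i = i} = t-ref (inj₁ i)

    c : ∀ {n} {a : U} → DefT {n} (λ _ → a)
    c {a = a} = t-ref (inj₂ a)

    weaken : ∀ {n} {f : Env n → U} → DefT f → DefT {suc n} (λ ρ → f (λ i → ρ (suc i)))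
    weaken (mkT d) = mkT $ dref d λ { zero → inj₁ zero ; (suc i) → inj₁ (suc (suc i)) }

    -- There are no function symbols, so a term enters a formula through its graph: some `u` equals
    -- the term and has the property.
    dterm : ∀ {n} {R : U → Env n → Set} {f : Env n → U} →
            Def {suc n} (λ ρ → R (ρ zero) (λ i → ρ (suc i))) → DefT f → Def (λ ρ → R (f ρ) ρ)
    dterm {n} {R} {f} d (mkT t) =
      d⇔ (λ ρ → mk⇔ (λ { (u , e , r) → subst (λ z → R z ρ) e r }) (λ r → f ρ , refl , r))
         (d∃ {R = λ u ρ → (u ≡ f ρ) × R u ρ} (d× t d))

    d∈ : ∀ {n} {f g : Env n → U} → DefT f → DefT g → Def (λ ρ → f ρ ∈ g ρ)
    d∈ {f = f} {g} s t = dterm {R = λ a ρ → a ∈ g ρ}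
      (dterm {R = λ b ρ → ρ zero ∈ b} (mkDef (atom₂ (inj₁ (suc zero)) (inj₁ zero)) (mem zero (suc zero)) (λ ρ → mk⇔ (λ x → x) (λ x → x))) (weaken t)) s

    d≡ : ∀ {n} {f g : Env n → U} → DefT f → DefT g → Def (λ ρ → f ρ ≡ g ρ)
    d≡ {f = f} {g} s t = dterm {R = λ b ρ → f ρ ≡ b} (d⇔ (λ ρ → mk⇔ sym sym) (dref (graph s) (λ i → inj₁ i))) t

    d𝒜 : ∀ {n} {f : Env n → U} → DefT f → Def (λ ρ → 𝒜 (f ρ))
    d𝒜 s = dterm {R = λ a ρ → 𝒜 a} (mkDef {arity = 1} (λ _ → inj₁ zero) (ur zero) (λ ρ → mk⇔ (λ x → x) (λ x → x))) s

    -- Rebuilding a formula from its atoms allows definable terms, and not merely coordinates and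
    -- parameters, to be put for its variables.
    dSat : ∀ {k n} (φ : Formula k) {f : Fin k → Env n → U} → (∀ i → DefT (f i)) →
           Def (λ ρ → Sat M φ (λ i → f i ρ))
    dSat (mem i j) t = d∈ (t i) (t j)
    dSat (ur i)    t = d𝒜 (t i)
    dSat (eq i j)  t = d≡ (t i) (t j)
    dSat fls       t = d⊥
    dSat (φ ⇒ ψ)   t = d→ (dSat φ t) (dSat ψ t)
    dSat {k} {n} (all φ) {f} t =
      d∀ (d⇔ (λ ρ → mk⇔ (Sat-cong φ λ { zero → refl ; (suc i) → refl })
                        (Sat-cong φ λ { zero → refl ; (suc i) → refl })) (dSat φ {f'} t'))
      where
      f' : Fin (suc k) → Env (suc n) → U
      f' zero    ρ = ρ zero
      f' (suc i) ρ = f i (λ j → ρ (suc j))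
      t' : ∀ i → DefT (f' i)
      t' zero    = v
      t' (suc i) = weaken (t i)

    dsub : ∀ {k n} {P : Env k → Set} {f : Fin k → Env n → U} → Def P → (∀ i → DefT (f i)) →
           Def (λ ρ → P (λ i → f i ρ))
    dsub {k} {n} {P} {f} (mkDef σ φ cor) t = d⇔ (λ ρ → cor (λ i → f i ρ)) (dSat φ (λ i → term (σ i)))
      where
      term : (r : Ref k) → DefT (λ ρ → ⟦ r ⟧ (λ i → f i ρ))
      term (inj₁ i) = t i
      term (inj₂ a) = c

  record DefR (R : U → Set) : Set where
    constructor mkR
    field relation : Def {1} (λ ρ → R (ρ zero))

  record DefR₂ (R : U → U → Set) : Set where
    constructor mkR₂
    field relation : Def {2} (λ ρ → R (ρ zero) (ρ (suc zero)))

  record DefR₃ (R : U → U → U → Set) : Set where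
    constructor mkR₃
    field relation : Def {3} (λ ρ → R (ρ zero) (ρ (suc zero)) (ρ (suc (suc zero))))

  -- The value is the first coordinate.
  record DefF (F : U → U) : Set where
    constructor mkF
    field relation : Def {2} (λ ρ → ρ zero ≡ F (ρ (suc zero)))

  record DefF₂ (F : U → U → U) : Set where
    constructor mkF₂
    field relation : Def {3} (λ ρ → ρ zero ≡ F (ρ (suc zero)) (ρ (suc (suc zero))))

  infixl 5 _$₁_ _$₂_ _$₃_ _⟨$⟩_ _⟨$⟩₂_

  opaque
    _$₁_ : ∀ {n} {R : U → Set} {f : Env n → U} → DefR R → DefT f → Def (λ ρ → R (f ρ))
    _$₁_ {f = f} (mkR d) s = dsub {f = λ _ → f} d (λ _ → s)

    _$₂_ : ∀ {n} {R : U → U → Set} {f g : Env n → U} → DefR₂ R → DefT f × DefT g → Def (λ ρ → R (f ρ) (g ρ))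
    _$₂_ {f = f} {g} (mkR₂ d) (s , t) = dsub {f = λ { zero → f ; (suc _) → g }} d (λ { zero → s ; (suc _) → t })

    _$₃_ : ∀ {n} {R : U → U → U → Set} {f g h : Env n → U} → DefR₃ R → DefT f × DefT g × DefT h →
           Def (λ ρ → R (f ρ) (g ρ) (h ρ))
    _$₃_ {f = f} {g} {h} (mkR₃ d) (s , t , r) =
      dsub {f = λ { zero → f ; (suc zero) → g ; (suc (suc _)) → h }} d
           (λ { zero → s ; (suc zero) → t ; (suc (suc _)) → r })

    _⟨$⟩_ : ∀ {n} {F : U → U} {f : Env n → U} → DefF F → DefT f → DefT (λ ρ → F (f ρ))
    _⟨$⟩_ {F = F} (mkF d) s = mkT $ _$₂_ {R = λ a b → a ≡ F b} (mkR₂ d) (v , weaken s)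

    _⟨$⟩₂_ : ∀ {n} {F : U → U → U} {f g : Env n → U} → DefF₂ F → DefT f × DefT g → DefT (λ ρ → F (f ρ) (g ρ))
    _⟨$⟩₂_ {F = F} (mkF₂ d) (s , t) = mkT $ _$₃_ {R = λ a b e → a ≡ F b e} (mkR₃ d) (v , weaken s , weaken t)

-- The axioms as definable operations.

module SetTheory (em : ExcludedMiddle 0ℓ) (M : Structure) (zfu : ZFUR M) where
  open Structure M
  open Satisfaction M

  Isset : U → Set
  Isset = IsSet M

  infix 4 _⊑_
  _⊑_ : U → U → Set
  _⊑_ = _⊆_ M

  ur-empty : ∀ {a z} → 𝒜 a → ¬ (z ∈ a)
  ur-empty {a} {z} α = proj₁ zfu a α z

  set-ext : ∀ {x y} → Isset x → Isset y → (∀ z → z ∈ x → z ∈ y) → (∀ z → z ∈ y → z ∈ x) → x ≡ y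
  set-ext {x} {y} sx sy h k = proj₁ (proj₂ zfu) x y sx sy (λ z → mk⇔ (h z) (k z))

  foundation : ∀ {x y} → y ∈ x → Σ U λ y → y ∈ x × (∀ z → z ∈ x → ¬ (z ∈ y))
  foundation {x} {y} y∈x = proj₁ (proj₂ (proj₂ zfu)) x (y , y∈x)

  pairing : ∀ x y → Σ U λ p → Isset p × x ∈ p × y ∈ p
  pairing = proj₁ (proj₂ (proj₂ (proj₂ zfu)))

  union : ∀ x → Σ U λ u → Isset u × (∀ y z → y ∈ x → z ∈ y → z ∈ u)
  union = proj₁ (proj₂ (proj₂ (proj₂ (proj₂ zfu))))

  powerset : ∀ x → Σ U λ p → Isset p × (∀ y → Isset y → y ⊑ x → y ∈ p)
  powerset = proj₁ (proj₂ (proj₂ (proj₂ (proj₂ (proj₂ zfu)))))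

  infinity : Σ U λ w → Isset w × (Σ U λ e → e ∈ w × IsEmptySet M e) ×
    (∀ y → y ∈ w → Σ U λ s → s ∈ w × Isset s × (∀ z → (z ∈ s) ⇔ (z ∈ y ⊎ z ≡ y)))
  infinity = proj₁ (proj₂ (proj₂ (proj₂ (proj₂ (proj₂ (proj₂ zfu))))))

  separation : ∀ {n} (φ : Formula (suc n)) (ρ : Fin n → U) (x : U) →
    Σ U λ y → Isset y × (∀ z → (z ∈ y) ⇔ (z ∈ x × Sat M φ (ext M z ρ)))
  separation = proj₁ (proj₂ (proj₂ (proj₂ (proj₂ (proj₂ (proj₂ (proj₂ zfu)))))))

  replacement : ∀ {n} (φ : Formula (suc (suc n))) (ρ : Fin n → U) (x : U) →
    (∀ u → u ∈ x →
       (Σ U λ v → Sat M φ (ext M v (ext M u ρ))) ×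
       (∀ v v' → Sat M φ (ext M v (ext M u ρ)) → Sat M φ (ext M v' (ext M u ρ)) → v ≡ v')) →
    Σ U λ y → Isset y × (∀ u → u ∈ x → Σ U λ v → v ∈ y × Sat M φ (ext M v (ext M u ρ)))
  replacement = proj₂ (proj₂ (proj₂ (proj₂ (proj₂ (proj₂ (proj₂ (proj₂ zfu)))))))

  u₀ : U
  u₀ = proj₁ infinity

  open Definability em M u₀

  module _ {k} {P : Env k → Set} (d : Def P) where
    private
      m = Def.arity d
      σ = Def.refs d

    freeRef : Ref k → Fin m → Fin (k + m)
    freeRef (inj₁ j) _ = j ↑ˡ m
    freeRef (inj₂ _) i = k ↑ʳ i

    parameter : Ref k → U
    parameter (inj₁ _) = u₀
    parameter (inj₂ a) = a

    -- The axiom schemes take their parameters from an environment, so slots that hold parameters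
    -- become variables placed after the `k` coordinates.
    unparametrised : Formula (k + m)
    unparametrised = rename (λ i → freeRef (σ i) i) (Def.formula d)

    unparametrised-correct : (E : Env (k + m)) → (∀ i → E (k ↑ʳ i) ≡ parameter (σ i)) →
                             Sat M unparametrised E ⇔ P (λ j → E (j ↑ˡ m))
    unparametrised-correct E h = ⇔-trans (Sat-rename (Def.formula d) _)
        (⇔-trans (mk⇔ (Sat-cong (Def.formula d) (λ i → e i (σ i) refl)) (Sat-cong (Def.formula d) (λ i → sym (e i (σ i) refl))))
                 (Def.correct d (λ j → E (j ↑ˡ m))))
      where
      e : ∀ i r → r ≡ σ i → E (freeRef r i) ≡ ⟦ r ⟧ (λ j → E (j ↑ˡ m))
      e i (inj₁ j) q = refl
      e i (inj₂ a) q = trans (h i) (cong parameter (sym q))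

  opaque
    sep : (P : U → Set) → DefR P → U → U
    sep P (mkR d) x = proj₁ (separation (unparametrised d) (λ i → parameter d (Def.refs d i)) x)

    sep-set : ∀ {P} {d : DefR P} {x} → Isset (sep P d x)
    sep-set {d = mkR d} {x} = proj₁ (proj₂ (separation (unparametrised d) (λ i → parameter d (Def.refs d i)) x))

    ∈sep : ∀ {P} {d : DefR P} {x z} → z ∈ sep P d x ⇔ (z ∈ x × P z)
    ∈sep {P} {mkR d} {x} {z} = ⇔-trans (proj₂ (proj₂ (separation (unparametrised d) τ x)) z)
        (mk⇔ (λ { (a , b) → a , to cor b }) (λ { (a , b) → a , from cor b }))
      where
      τ : Fin (Def.arity d) → U
      τ i = parameter d (Def.refs d i)
      cor : Sat M (unparametrised d) (ext M z τ) ⇔ P z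
      cor = unparametrised-correct d (ext M z τ) (λ i → refl)

  opaque
    ⋃ : U → U
    ⋃ x = sep (λ z → Σ U λ y → y ∈ x × z ∈ y) (mkR (d∃ (d× (d∈ v c) (d∈ v v)))) (proj₁ (union x))

    ⋃-set : ∀ {x} → Isset (⋃ x)
    ⋃-set = sep-set

    ∈⋃ : ∀ {x z} → z ∈ ⋃ x ⇔ Σ U λ y → y ∈ x × z ∈ y
    ∈⋃ {x} = mk⇔ (λ h → proj₂ (to ∈sep h))
                 (λ { (y , a , b) → from ∈sep (proj₂ (proj₂ (union x)) _ _ a b , y , a , b) })

  opaque
    pair : U → U → U
    pair x y = sep (λ z → z ≡ x ⊎ z ≡ y) (mkR (d⊎ (d≡ v c) (d≡ v c))) (proj₁ (pairing x y))

    pair-set : ∀ {x y} → Isset (pair x y)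
    pair-set = sep-set

    ∈pair : ∀ {x y z} → z ∈ pair x y ⇔ (z ≡ x ⊎ z ≡ y)
    ∈pair {x} {y} = mk⇔ (λ h → proj₂ (to ∈sep h)) λ
      { (inj₁ refl) → from ∈sep (proj₁ (proj₂ (proj₂ (pairing x y))) , inj₁ refl)
      ; (inj₂ refl) → from ∈sep (proj₂ (proj₂ (proj₂ (pairing x y))) , inj₂ refl) }

  opaque
    ∅ : U
    ∅ = sep (λ _ → ⊥) (mkR d⊥) u₀

    ∅-set : Isset ∅
    ∅-set = sep-set

    ∉∅ : ∀ {z} → ¬ (z ∈ ∅)
    ∉∅ h = proj₂ (to ∈sep h)

  disset : ∀ {n} {f : Env n → U} → DefT f → Def (λ ρ → Isset (f ρ))
  disset t = d¬ (d𝒜 t)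

  d⊑ : ∀ {n} {f g : Env n → U} → DefT f → DefT g → Def (λ ρ → f ρ ⊑ g ρ)
  d⊑ s t = d∀ (d→ (d∈ v (weaken s)) (d∈ v (weaken t)))

  opaque
    𝒫 : U → U
    𝒫 x = sep (λ z → Isset z × z ⊑ x) (mkR (d× (disset v) (d⊑ v c))) (proj₁ (powerset x))

    𝒫-set : ∀ {x} → Isset (𝒫 x)
    𝒫-set = sep-set

    ∈𝒫 : ∀ {x z} → z ∈ 𝒫 x ⇔ (Isset z × z ⊑ x)
    ∈𝒫 {x} = mk⇔ (λ h → proj₂ (to ∈sep h))
                 (λ { (a , b) → from ∈sep (proj₂ (proj₂ (powerset x)) _ a b , a , b) })

  replacement-bound : ∀ {F} → DefF F → (x : U) → Σ U λ y → ∀ u → u ∈ x → F u ∈ y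
  replacement-bound {F} (mkF d) x = proj₁ r , bound
    where
    τ : Fin (Def.arity d) → U
    τ i = parameter d (Def.refs d i)
    cor : ∀ u w → Sat M (unparametrised d) (ext M w (ext M u τ)) ⇔ (w ≡ F u)
    cor u w = unparametrised-correct d (ext M w (ext M u τ)) (λ i → refl)
    r = replacement (unparametrised d) τ x λ u _ →
          (F u , from (cor u (F u)) refl) ,
          λ w w' s s' → trans (to (cor u w) s) (sym (to (cor u w') s'))
    bound : ∀ u → u ∈ x → F u ∈ proj₁ r
    bound u a with proj₂ (proj₂ r) u a
    ... | w , w∈ , s = subst (_∈ proj₁ r) (to (cor u w) s) w∈

  opaque
    img : (F : U → U) → DefF F → U → U
    img F d x = sep (λ z → Σ U λ u → u ∈ x × z ≡ F u)
                    (mkR (d∃ (d× (d∈ v c) (d≡ v (d ⟨$⟩ v))))) (proj₁ (replacement-bound d x))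

    img-set : ∀ {F} {d : DefF F} {x} → Isset (img F d x)
    img-set = sep-set

    ∈img : ∀ {F} {d : DefF F} {x z} → z ∈ img F d x ⇔ (Σ U λ u → u ∈ x × z ≡ F u)
    ∈img {F} {d} {x} = mk⇔ (λ h → proj₂ (to ∈sep h))
      λ { (u , a , refl) → from ∈sep (proj₂ (replacement-bound d x) u a , u , a , refl) }

  infixr 6 _∪_
  infixr 7 _∖_
  _∪_ : U → U → U
  x ∪ y = ⋃ (pair x y)

  sg : U → U
  sg x = pair x x

  op : U → U → U
  op x y = pair (sg x) (pair x y)

  ∈∪ : ∀ {x y z} → z ∈ (x ∪ y) ⇔ (z ∈ x ⊎ z ∈ y)
  ∈∪ = mk⇔
    (λ h → case to ∈⋃ h of λ (y , a , b) → case to ∈pair a of λ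
           { (inj₁ refl) → inj₁ b ; (inj₂ refl) → inj₂ b })
    λ { (inj₁ a) → from ∈⋃ (_ , from ∈pair (inj₁ refl) , a)
      ; (inj₂ a) → from ∈⋃ (_ , from ∈pair (inj₂ refl) , a) }

  ∈sg : ∀ {x z} → z ∈ sg x ⇔ z ≡ x
  ∈sg = mk⇔ (λ h → [ (λ e → e) , (λ e → e) ]′ (to ∈pair h)) (λ e → from ∈pair (inj₁ e))

  opaque
    _∖_ : U → U → U
    x ∖ y = sep (λ z → ¬ (z ∈ y)) (mkR (d¬ (d∈ v c))) x

    ∖-set : ∀ {x y} → Isset (x ∖ y)
    ∖-set = sep-set

    ∈∖ : ∀ {x y z} → z ∈ (x ∖ y) ⇔ (z ∈ x × ¬ (z ∈ y))
    ∈∖ = ∈sep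

  sg-injective : ∀ {x y} → sg x ≡ sg y → x ≡ y
  sg-injective {x} e = to ∈sg (subst (x ∈_) e (from ∈sg refl))

  pair-injectiveʳ : ∀ {x y z} → pair x y ≡ pair x z → y ≡ z
  pair-injectiveʳ {x} {y} {z} e with to ∈pair (subst (y ∈_) e (from ∈pair (inj₂ refl)))
  ... | inj₂ q = q
  ... | inj₁ refl with to ∈pair (subst (z ∈_) (sym e) (from ∈pair (inj₂ refl)))
  ...   | inj₁ q = sym q
  ...   | inj₂ q = sym q

  op-injectiveˡ : ∀ {x y x' y'} → op x y ≡ op x' y' → x ≡ x'
  op-injectiveˡ {x} {y} {x'} {y'} e with to ∈pair (subst (sg x ∈_) e (from ∈pair (inj₁ refl)))
  ... | inj₁ q = sg-injective q
  ... | inj₂ q = sym (to ∈sg (subst (x' ∈_) (sym q) (from ∈pair (inj₁ refl))))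

  op-injectiveʳ : ∀ {x y x' y'} → op x y ≡ op x' y' → y ≡ y'
  op-injectiveʳ e with op-injectiveˡ e
  ... | refl = pair-injectiveʳ (pair-injectiveʳ e)

  opaque
    -- By Extensionality, `a ≡ f ρ` says that `a` is a set with the prescribed members, so a
    -- definition of membership in the value defines the term itself.
    set-valued : ∀ {n} {f : Env n → U} {R : U → Env n → Set} → (∀ ρ → Isset (f ρ)) →
                 (∀ ρ z → z ∈ f ρ ⇔ R z ρ) → Def {suc n} (λ ρ → R (ρ zero) (λ i → ρ (suc i))) → DefT f
    set-valued {f = f} {R} s h d = mkT $ d⇔
      (λ ρ → mk⇔ (λ { (s' , h') → set-ext s' (s _) (λ z a → from (h (λ i → ρ (suc i)) z) (to (h' z) a))
                                                    (λ z a → from (h' z) (to (h (λ i → ρ (suc i)) z) a)) })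
                 (λ e → subst (λ a → Isset a × (∀ z → z ∈ a ⇔ R z _)) (sym e) (s _ , h (λ i → ρ (suc i)))))
      (d× (disset v) (d∀ (d⟷ (d∈ v v) (dref d λ { zero → inj₁ zero ; (suc i) → inj₁ (suc (suc i)) }))))

  t⋃ : ∀ {n} {f : Env n → U} → DefT f → DefT (λ ρ → ⋃ (f ρ))
  t⋃ t = set-valued (λ _ → ⋃-set) (λ _ _ → ∈⋃) (d∃ (d× (d∈ v (weaken (weaken t))) (d∈ v v)))

  tpair : ∀ {n} {f g : Env n → U} → DefT f → DefT g → DefT (λ ρ → pair (f ρ) (g ρ))
  tpair s t = set-valued (λ _ → pair-set) (λ _ _ → ∈pair) (d⊎ (d≡ v (weaken s)) (d≡ v (weaken t)))

  t𝒫 : ∀ {n} {f : Env n → U} → DefT f → DefT (λ ρ → 𝒫 (f ρ))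
  t𝒫 t = set-valued (λ _ → 𝒫-set) (λ _ _ → ∈𝒫) (d× (disset v) (d⊑ v (weaken t)))

  timg : ∀ {n F} {d : DefF F} {f : Env n → U} → DefT f → DefT (λ ρ → img F d (f ρ))
  timg {d = d} t = set-valued (λ _ → img-set) (λ _ _ → ∈img) (d∃ (d× (d∈ v (weaken (weaken t))) (d≡ v (d ⟨$⟩ v))))

  t∪ : ∀ {n} {f g : Env n → U} → DefT f → DefT g → DefT (λ ρ → f ρ ∪ g ρ)
  t∪ s t = t⋃ (tpair s t)

  tsg : ∀ {n} {f : Env n → U} → DefT f → DefT (λ ρ → sg (f ρ))
  tsg t = tpair t t

  top : ∀ {n} {f g : Env n → U} → DefT f → DefT g → DefT (λ ρ → op (f ρ) (g ρ))
  top s t = tpair (tsg s) (tpair s t)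

  t∖ : ∀ {n} {f g : Env n → U} → DefT f → DefT g → DefT (λ ρ → f ρ ∖ g ρ)
  t∖ s t = set-valued (λ _ → ∖-set) (λ _ _ → ∈∖) (d× (d∈ v (weaken s)) (d¬ (d∈ v (weaken t))))

  F₁ : {F : U → U} → DefT {1} (λ ρ → F (ρ zero)) → DefF F
  F₁ (mkT d) = mkF d

  F₂ : {F : U → U → U} → DefT {2} (λ ρ → F (ρ zero) (ρ (suc zero))) → DefF₂ F
  F₂ (mkT d) = mkF₂ d

  opaque
    -- The default is a function of `x`, not a constant, so that a partial exchange of urelements
    -- can be continued by the identity.
    the : (U → U → Set) → (U → U) → U → U
    the R F x with em {Σ U (R x)}
    ... | yes (y , _) = y
    ... | no _        = F x

    the-spec : ∀ {R F} → (∀ x y y' → R x y → R x y' → y ≡ y') → ∀ {x y} → R x y → the R F x ≡ y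
    the-spec {R} uniq {x} r with em {Σ U (R x)}
    ... | yes (y' , r') = uniq _ _ _ r' r
    ... | no h          = ⊥-elim (h (_ , r))

    the-default : ∀ {R F x} → ¬ (Σ U (R x)) → the R F x ≡ F x
    the-default {R} {x = x} h with em {Σ U (R x)}
    ... | yes r = ⊥-elim (h r)
    ... | no _  = refl

    dthe : ∀ {R F} → (∀ x y y' → R x y → R x y' → y ≡ y') → DefR₂ R → DefF F → DefF (the R F)
    dthe {R} {F} uniq dR dF = mkF $ d⇔
      (λ ρ → mk⇔ (λ { (inj₁ r) → sym (the-spec uniq r) ; (inj₂ (h , e)) → trans e (sym (the-default h)) })
                 (graph ρ))
      (d⊎ (dR $₂ (v , v)) (d× (d¬ (d∃ (dR $₂ (v , v)))) (d≡ v (dF ⟨$⟩ v))))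
      where
      graph : ∀ (ρ : Env 2) → ρ zero ≡ the R F (ρ (suc zero)) →
              R (ρ (suc zero)) (ρ zero) ⊎ ¬ (Σ U (R (ρ (suc zero)))) × ρ zero ≡ F (ρ (suc zero))
      graph ρ e with em {Σ U (R (ρ (suc zero)))}
      ... | yes (y , r) = inj₁ (subst (R (ρ (suc zero))) (sym e) r)
      ... | no h        = inj₂ (h , e)

  Rel⇔ : ∀ {r x y} → Rel M r x y ⇔ op x y ∈ r
  Rel⇔ {r} {x} {y} = mk⇔
      (λ { (p , p∈r , h) → subst (_∈ r) (opair≡ h) p∈r })
      (λ h → op x y , h , isOPair)
    where
    upair≡ : ∀ {p x y} → IsUPair M p x y → p ≡ pair x y
    upair≡ (s , h) = set-ext s pair-set (λ z a → from ∈pair (to (h z) a)) (λ z a → from (h z) (to ∈pair a))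
    opair≡ : ∀ {p} → IsOPair M p x y → p ≡ op x y
    opair≡ (s , t , hs , ht , hp) = trans (upair≡ hp) (cong₂ pair (upair≡ hs) (upair≡ ht))
    isUPair : ∀ {x y} → IsUPair M (pair x y) x y
    isUPair = pair-set , λ z → ∈pair
    isOPair : IsOPair M (op x y) x y
    isOPair = sg x , pair x y , isUPair , isUPair , isUPair

  IsOPair⇔ : ∀ {p x y} → IsOPair M p x y ⇔ p ≡ op x y
  IsOPair⇔ {p} {x} {y} = mk⇔
      (λ h → sym (to ∈sg (to (Rel⇔ {sg p} {x} {y}) (p , from ∈sg refl , h))))
      (λ e → let (q , q∈ , h) = from (Rel⇔ {sg (op x y)} {x} {y}) (from ∈sg refl) in
             subst (λ q → IsOPair M q x y) (trans (to ∈sg q∈) (sym e)) h)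

  -- Iteration and recursion

  record Iterates (G : U → U) (a : U) : Set₁ where
    field
      carrier   : U
      base      : a ∈ carrier
      step      : ∀ {s} → s ∈ carrier → G s ∈ carrier
      induction : ∀ {P} → DefR P → P a → (∀ s → s ∈ carrier → P s → P (G s)) → ∀ {s} → s ∈ carrier → P s

    -- Comparability of `s` and `s'` passes to `G s` and `G s'` by monotonicity, and `a` lies below
    -- every iterate.
    chain : (∀ {x y} → x ⊑ y → G x ⊑ G y) → a ⊑ G a →
            ∀ {s s'} → s ∈ carrier → s' ∈ carrier → s ⊑ s' ⊎ s' ⊑ s
    chain mono a⊑Ga m m' = induction {P = λ s → ∀ s' → s' ∈ carrier → s ⊑ s' ⊎ s' ⊑ s}
        (mkR (d∀ (d→ (d∈ v c) (d⊎ (d⊑ v v) (d⊑ v v)))))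
        (λ s' m' → inj₁ (least m'))
        -- The inner induction serves only to distinguish whether the second iterate is `a` or of
        -- the form `G s'`; in the latter case the outer hypothesis `h` is applied to `s'`.
        (λ s m h s' m' → induction {P = λ s' → G s ⊑ s' ⊎ s' ⊑ G s}
           (mkR (d⊎ (d⊑ c v) (d⊑ v c))) (inj₂ (least (step m)))
           (λ s' m' _ → [ (λ i → inj₁ (mono i)) , (λ i → inj₂ (mono i)) ]′ (h s' m')) m')
        m _ m'
      where
      least : ∀ {s} → s ∈ carrier → a ⊑ s
      least = induction {P = λ s → a ⊑ s} (mkR (d⊑ c v)) (λ _ h → h) (λ s _ i z h → mono i z (a⊑Ga z h))

  succ : U → U
  succ y = y ∪ sg y

  ∈succ : ∀ {y} → y ∈ succ y
  ∈succ = from ∈∪ (inj₂ (from ∈sg refl))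

  no-2-cycle : ∀ {x y} → x ∈ y → ¬ (y ∈ x)
  no-2-cycle {x} {y} h k with foundation {pair x y} (from ∈pair (inj₁ refl))
  ... | z , z∈ , dis with to ∈pair z∈
  ...   | inj₁ refl = dis y (from ∈pair (inj₂ refl)) k
  ...   | inj₂ refl = dis x (from ∈pair (inj₁ refl)) h

  succ-injective : ∀ {x y} → succ x ≡ succ y → x ≡ y
  succ-injective {x} {y} e with to ∈∪ (subst (x ∈_) e ∈succ) | to ∈∪ (subst (y ∈_) (sym e) ∈succ)
  ... | inj₂ h | _      = to ∈sg h
  ... | inj₁ _ | inj₂ k = sym (to ∈sg k)
  ... | inj₁ h | inj₁ k = ⊥-elim (no-2-cycle h k)

  module _ {G : U → U} (dG : DefF G) (a : U) where
    private
      Derivation : U → Set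
      Derivation f = ∀ p → p ∈ f → p ≡ op ∅ a ⊎ Σ U λ m → Σ U λ w → op m w ∈ f × p ≡ op (succ m) (G w)

      It : U → U → Set
      It n s = Σ U λ f → Derivation f × op n s ∈ f

      dIt : DefR₂ It
      dIt = mkR₂ (d∃ (d× (d∀ (d→ (d∈ v v) (d⊎ (d≡ v c)
        (d∃ (d∃ (d× (d∈ (top v v) v) (d≡ v (top (t∪ v (tsg v)) (dG ⟨$⟩ v)))))))))
        (d∈ (top v v) v)))

      It-zero : It ∅ a
      It-zero = sg (op ∅ a) , (λ p h → inj₁ (to ∈sg h)) , from ∈sg refl

      It-zero-unique : ∀ {s} → It ∅ s → a ≡ s
      It-zero-unique (f , D , m) with D _ m
      ... | inj₁ e               = sym (op-injectiveʳ e)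
      ... | inj₂ (m , w , _ , e) = ⊥-elim (∉∅ (subst (m ∈_) (sym (op-injectiveˡ e)) ∈succ))

      It-succ : ∀ {n s} → It n s → It (succ n) (G s)
      It-succ {n} {s} (f , D , m) = f ∪ sg p , D' , from ∈∪ (inj₂ (from ∈sg refl))
        where
        p = op (succ n) (G s)
        D' : Derivation (f ∪ sg p)
        D' q h with to ∈∪ h
        ... | inj₂ k = inj₂ (n , s , from ∈∪ (inj₁ m) , to ∈sg k)
        ... | inj₁ k with D q k
        ...   | inj₁ e = inj₁ e
        ...   | inj₂ (m , w , l , e) = inj₂ (m , w , from ∈∪ (inj₁ l) , e)

      It-pred : ∀ {n s} → It (succ n) s → Σ U λ w → It n w × s ≡ G w
      It-pred (f , D , m) with D _ m
      ... | inj₁ e = ⊥-elim (∉∅ (subst (_ ∈_) (op-injectiveˡ e) ∈succ))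
      ... | inj₂ (m , w , l , e) with succ-injective (op-injectiveˡ e)
      ...   | refl = w , (f , D , l) , op-injectiveʳ e

      -- Infinity provides some inductive set, perhaps with members other than numerals. Uniqueness
      -- is therefore built into the relation, where it passes from `n` to `succ n`, instead of
      -- being proved for all members of that set.
      UIt : U → U → Set
      UIt n s = It n s × (∀ s' → It n s' → s ≡ s')

      dUIt : DefR₂ UIt
      dUIt = mkR₂ (d× (dIt $₂ (v , v)) (d∀ (d→ (dIt $₂ (v , v)) (d≡ v v))))

      UIt-unique : ∀ n s s' → UIt n s → UIt n s' → s ≡ s'
      UIt-unique _ _ _ (_ , h) (k , _) = h _ k

      UIt-succ : ∀ {n s} → UIt n s → UIt (succ n) (G s)
      UIt-succ (i , u) = It-succ i , λ s' i' → let (w , j , e) = It-pred i' in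
        trans (cong G (u w j)) (sym e)

      dval : DefF (the UIt (λ _ → ∅))
      dval = dthe UIt-unique dUIt (F₁ c)

      ω = proj₁ infinity

      ∅∈ω : ∅ ∈ ω
      ∅∈ω = let (e , e∈ω , se , he) = proj₁ (proj₂ (proj₂ infinity)) in
        subst (_∈ ω) (set-ext se ∅-set (λ z h → ⊥-elim (he z h)) (λ z h → ⊥-elim (∉∅ h))) e∈ω

      succ∈ω : ∀ {y} → y ∈ ω → succ y ∈ ω
      succ∈ω {y} y∈ω = let (s , s∈ω , ss , hs) = proj₂ (proj₂ (proj₂ infinity)) y y∈ω in
        subst (_∈ ω) (set-ext ss ⋃-set
          (λ z h → from ∈∪ ([ inj₁ , (λ e → inj₂ (from ∈sg e)) ]′ (to (hs z) h)))
          (λ z h → from (hs z) ([ inj₁ , (λ e → inj₂ (to ∈sg e)) ]′ (to ∈∪ h)))) s∈ω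

      Closed : U → Set
      Closed i = a ∈ i × (∀ y → y ∈ i → G y ∈ i)

      dB : DefR (λ s → Σ U λ n → n ∈ ω × UIt n s)
      dB = mkR (d∃ (d× (d∈ v c) (dUIt $₂ (v , v))))

      B = sep (λ s → Σ U λ n → n ∈ ω × UIt n s) dB (img (the UIt (λ _ → ∅)) dval ω)

      ∈B : ∀ {s} n → n ∈ ω → UIt n s → s ∈ B
      ∈B n n∈ω u = from ∈sep (from ∈img (n , n∈ω , sym (the-spec UIt-unique u)) , n , n∈ω , u)

      B-closed : Closed B
      B-closed = ∈B ∅ ∅∈ω (It-zero , λ _ → It-zero-unique) , λ y h →
        let (n , n∈ω , u) = proj₂ (to ∈sep h) in ∈B (succ n) (succ∈ω n∈ω) (UIt-succ u)

      dClosed : DefR Closed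
      dClosed = mkR (d× (d∈ c v) (d∀ (d→ (d∈ v v) (d∈ (dG ⟨$⟩ v) v))))

      -- This is the intersection of all closed sets; separating it from the closed set `B` makes it
      -- a set.
      S = sep (λ s → ∀ i → Closed i → s ∈ i) (mkR (d∀ (d→ (dClosed $₁ v) (d∈ v v)))) B

      ∈S : ∀ {s} → (∀ i → Closed i → s ∈ i) → s ∈ S
      ∈S h = from ∈sep (h B B-closed , h)

    opaque
      iterate : Iterates G a
      iterate = record
        { carrier   = S
        ; base      = ∈S (λ i h → proj₁ h)
        ; step      = step
        -- The members of `S` with property `P` form a closed set, which therefore includes all of
        -- `S`.
        ; induction = λ {P} d b st {s} m → proj₂ (to ∈sep (proj₂ (to ∈sep m) (sep P d S)
            ( from ∈sep (∈S (λ i h → proj₁ h) , b)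
            , λ y h → let (y∈S , p) = to ∈sep h in from ∈sep (step y∈S , st y y∈S p)))) }
        where
        step : ∀ {s} → s ∈ S → G s ∈ S
        step h = ∈S (λ i k → proj₂ k _ (proj₂ (to ∈sep h) i k))

  opaque
    transitive-superset : ∀ x → Σ U λ t → Transitive M t × x ⊑ t
    transitive-superset x = ⋃ S , (⋃-set , λ y z y∈ z∈y → let (s , s∈ , y∈s) = to ∈⋃ y∈ in
        from ∈⋃ (⋃ s , step s∈ , from ∈⋃ (y , y∈s , z∈y))) , λ z h → from ∈⋃ (x , base , h)
      where open Iterates (iterate (F₁ {⋃} (t⋃ v)) x) renaming (carrier to S)

  opaque
    transitive-containing : ∀ x → Σ U λ t → Transitive M t × x ∈ t
    transitive-containing x = let (t , tr , h) = transitive-superset (sg x) in t , tr , h x (from ∈sg refl)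

  opaque
    ∈-induction : ∀ {P} → DefR P → (∀ x → (∀ y → y ∈ x → P y) → P x) → ∀ x → P x
    ∈-induction {P} d h x = dne λ ¬Px →
      let (t , (_ , tr) , x∈t) = transitive-containing x
          (y , y∈ , min) = foundation (from (∈sep {P = λ z → ¬ P z} {mkR (d¬ (d $₁ v))}) (x∈t , ¬Px))
          (y∈t , ¬Py) = to ∈sep y∈
      in ¬Py (h y λ z z∈y → dne λ ¬Pz → min z (from ∈sep (tr y z y∈t z∈y , ¬Pz)) z∈y)

  -- The step function sees only the set of values at the members of `x`, not which member has which
  -- value. Both the action of a permutation on sets and the cumulative hierarchy have this form.
  record ∈-Recursive (G : U → U → U) : Set where
    field
      fun       : U → U
      definable : DefF fun
      unfold    : ∀ x → fun x ≡ G x (img fun definable x)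

  module _ {G : U → U → U} (dG : DefF₂ G) where
    private
      Step : (U → U → Set) → U → U → Set
      Step R y w = Σ U λ h → Isset h × w ≡ G y h × (∀ w' → w' ∈ h ⇔ Σ U λ y' → y' ∈ y × R y' w') ×
                             (∀ y' → y' ∈ y → Σ U λ w' → R y' w')

      Derivation : U → Set
      Derivation f = ∀ y w → op y w ∈ f → Step (λ y' w' → op y' w' ∈ f) y w

      Rec : U → U → Set
      Rec x w = Σ U λ f → Derivation f × op x w ∈ f

      opaque
        dRec : DefR₂ Rec
        dRec = mkR₂ (d∃ (d× (d∀ (d∀ (d→ (d∈ (top v v) v) (d∃ (d× (disset v) (d× (d≡ v (dG ⟨$⟩₂ (v , v)))
            (d× (d∀ (d⟷ (d∈ v v) (d∃ (d× (d∈ v v) (d∈ (top v v) v)))))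
                (d∀ (d→ (d∈ v v) (d∃ (d∈ (top v v) v)))))))))))
          (d∈ (top v v) v)))

      opaque
        Rec-unique : ∀ x w w' → Rec x w → Rec x w' → w ≡ w'
        Rec-unique = ∈-induction
            (mkR (d∀ (d∀ (d→ (dRec $₂ (v , v)) (d→ (dRec $₂ (v , v)) (d≡ v v)))))) λ x ih w w' r r' →
            let (f , D , m) = r ; (f' , D' , m') = r'
                (h , sh , e , hh , _) = D x w m ; (h' , sh' , e' , hh' , _) = D' x w' m'
            in trans e (trans (cong (G x) (set-ext sh sh' (incl ih r r') (incl ih r' r))) (sym e'))
          where
          incl : ∀ {x w w'} → (∀ y → y ∈ x → ∀ w w' → Rec y w → Rec y w' → w ≡ w') →
                 ((f , D , m) : Rec x w) ((f' , D' , m') : Rec x w') →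
                 proj₁ (D x w m) ⊑ proj₁ (D' x w' m')
          incl ih (f , D , m) (f' , D' , m') z z∈h =
            let (_ , _ , _ , hh , _) = D _ _ m ; (_ , _ , _ , hh' , tot') = D' _ _ m'
                (y , y∈x , l) = to (hh z) z∈h ; (z' , l') = tot' y y∈x
                z≡z' = ih y y∈x z z' (f , D , l) (f' , D' , l')
            in from (hh' z) (y , y∈x , subst (λ z → op y z ∈ f') (sym z≡z') l')

      opaque
        Rec-step : ∀ {x w} → Rec x w → Step Rec x w
        Rec-step {x} {w} (f , D , m) = let (h , sh , e , hh , tot) = D x w m in
          h , sh , e ,
          (λ w' → mk⇔ (λ k → let (y , y∈x , l) = to (hh w') k in y , y∈x , f , D , l)
                      (λ (y , y∈x , r) → let (w'' , l) = tot y y∈x in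
                         from (hh w') (y , y∈x , subst (λ z → op y z ∈ f) (Rec-unique y _ _ (f , D , l) r) l))) ,
          λ y y∈x → let (w' , l) = tot y y∈x in w' , f , D , l

      val : U → U
      val = the Rec (λ _ → ∅)

      dval : DefF val
      dval = dthe Rec-unique dRec (F₁ c)

      val-Rec : ∀ {x w} → Rec x w → val x ≡ w
      val-Rec = the-spec Rec-unique

      opaque
        Rec-total : ∀ x → Σ U (Rec x)
        -- Assuming that `x` has no value makes it safe to add the pair `op x w₀`: everything with a
        -- value has only members with values, so `x` is not a member of any first coordinate
        -- already present.
        Rec-total = ∈-induction (mkR (d∃ (dRec $₂ (v , v)))) λ x ih → dne λ ¬r → ¬r (extend x ih ¬r)
          where
          module _ (x : U) (ih : ∀ y → y ∈ x → Σ U (Rec y)) (¬r : ¬ Σ U (Rec x)) where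
            T = transitive-superset x
            t = proj₁ T
            dgraph : DefR (λ p → Σ U λ y → Σ U λ w → p ≡ op y w × Rec y w)
            dgraph = mkR (d∃ (d∃ (d× (d≡ v (top v v)) (dRec $₂ (v , v)))))
            f = sep _ dgraph (img (λ y → op y (val y)) (F₁ (top v (dval ⟨$⟩ v))) t)
            f-in : ∀ {y w} → y ∈ t → Rec y w → op y w ∈ f
            f-in {y} {w} y∈t r = from ∈sep (from ∈img (y , y∈t , cong (op y) (sym (val-Rec r))) , y , w , refl , r)
            f-out : ∀ {y w} → op y w ∈ f → y ∈ t × Rec y w
            f-out {y} {w} h =
              let (a , (y' , w' , e , r)) = to ∈sep h
                  (y'' , y''∈t , e') = to ∈img a
              in subst (_∈ t) (sym (op-injectiveˡ e')) y''∈t ,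
                 subst₂ Rec (sym (op-injectiveˡ e)) (sym (op-injectiveʳ e)) r
            w₀ = G x (img val dval x)
            f⁺ = f ∪ sg (op x w₀)
            f⁺-out : ∀ {y w} → op y w ∈ f⁺ → op y w ∈ f ⊎ y ≡ x × w ≡ w₀
            f⁺-out h with to ∈∪ h
            ... | inj₁ a = inj₁ a
            ... | inj₂ a = inj₂ (op-injectiveˡ (to ∈sg a) , op-injectiveʳ (to ∈sg a))
            f⁺-below : ∀ {y} → (∀ y' → y' ∈ y → y' ∈ t × Σ U (Rec y')) → ∀ {y' w'} → y' ∈ y → op y' w' ∈ f⁺ → Rec y' w'
            f⁺-below g y'∈y h with f⁺-out h
            ... | inj₁ a = proj₂ (f-out a)
            ... | inj₂ (refl , _) = ⊥-elim (¬r (proj₂ (g x y'∈y)))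
            D⁺ : Derivation f⁺
            D⁺ y w h with f⁺-out h
            ... | inj₁ a =
              let (y∈t , r) = f-out a ; (h , sh , e , hh , tot) = Rec-step r
                  g = λ y' y'∈y → proj₂ (proj₁ (proj₂ T)) y y' y∈t y'∈y , tot y' y'∈y
              in h , sh , e ,
                 (λ w' → mk⇔ (λ k → let (y' , y'∈y , r') = to (hh w') k in
                                 y' , y'∈y , from ∈∪ (inj₁ (f-in (proj₁ (g y' y'∈y)) r')))
                             (λ (y' , y'∈y , l) → from (hh w') (y' , y'∈y , f⁺-below g y'∈y l))) ,
                 λ y' y'∈y → let (w' , r') = tot y' y'∈y in w' , from ∈∪ (inj₁ (f-in (proj₁ (g y' y'∈y)) r'))
            ... | inj₂ (refl , refl) =
              img val dval x , img-set , refl ,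
              (λ w' → mk⇔ (λ k → let (y' , y'∈x , e) = to ∈img k ; (w'' , r) = ih y' y'∈x in
                              y' , y'∈x , from ∈∪ (inj₁ (f-in (proj₁ (g y' y'∈x))
                                (subst (Rec y') (trans (sym (val-Rec r)) (sym e)) r))))
                          (λ (y' , y'∈x , l) → from ∈img (y' , y'∈x , sym (val-Rec (f⁺-below g y'∈x l))))) ,
              λ y' y'∈x → let (w' , r) = ih y' y'∈x in w' , from ∈∪ (inj₁ (f-in (proj₁ (g y' y'∈x)) r))
              where
              g : ∀ y' → y' ∈ x → y' ∈ t × Σ U (Rec y')
              g y' y'∈x = proj₂ (proj₂ T) y' y'∈x , ih y' y'∈x
            extend : Σ U (Rec x)
            extend = w₀ , f⁺ , D⁺ , from ∈∪ (inj₂ (from ∈sg refl))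

    opaque
      ∈-recursion : ∈-Recursive G
      ∈-recursion = record
        { fun       = val
        ; definable = dval
        ; unfold    = λ x → let (w , r) = Rec-total x ; (h , sh , e , hh , tot) = Rec-step r in
            trans (val-Rec r) (trans e (cong (G x) (set-ext sh img-set
              (λ z k → let (y , y∈x , r') = to (hh z) k in from ∈img (y , y∈x , sym (val-Rec r')))
              (λ z k → let (y , y∈x , e') = to ∈img k ; (z' , r') = tot y y∈x in
                       from (hh z) (y , y∈x , subst (Rec y) (trans (sym (val-Rec r')) (sym e')) r'))))) }

  -- Automorphisms and the cumulative hierarchy

  -- Only exchanges occur, and for an involution every preservation property already contains its
  -- converse.
  record Automorphism : Set where
    field
      fun        : U → U
      involutive : ∀ x → fun (fun x) ≡ x
      preserve-∈ : ∀ {x y} → x ∈ y → fun x ∈ fun y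
      preserve-𝒜 : ∀ {x} → 𝒜 x → 𝒜 (fun x)

    reflect-∈ : ∀ {x y} → fun x ∈ fun y → x ∈ y
    reflect-∈ h = subst₂ _∈_ (involutive _) (involutive _) (preserve-∈ h)

    reflect-𝒜 : ∀ {x} → 𝒜 (fun x) → 𝒜 x
    reflect-𝒜 h = subst 𝒜 (involutive _) (preserve-𝒜 h)

    ∈-fun : ∀ {x y} → x ∈ fun y → fun x ∈ y
    ∈-fun h = subst (_ ∈_) (involutive _) (preserve-∈ h)

    preserve-Sat : ∀ {n} (φ : Formula n) {ρ : Env n} → Sat M φ ρ ⇔ Sat M φ (λ i → fun (ρ i))
    preserve-Sat (mem i j) = mk⇔ preserve-∈ reflect-∈
    preserve-Sat (ur i)    = mk⇔ preserve-𝒜 reflect-𝒜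
    preserve-Sat (eq i j)  = mk⇔ (cong fun) (λ e → trans (sym (involutive _)) (trans (cong fun e) (involutive _)))
    preserve-Sat fls       = mk⇔ (λ s → s) (λ s → s)
    preserve-Sat (φ ⇒ ψ)   = mk⇔ (λ s p → to (preserve-Sat ψ) (s (from (preserve-Sat φ) p)))
                                 (λ s p → from (preserve-Sat ψ) (s (to (preserve-Sat φ) p)))
    preserve-Sat (all φ)   = mk⇔
      (λ s u → Sat-cong φ (λ { zero → involutive u ; (suc i) → refl }) (to (preserve-Sat φ) (s (fun u))))
      (λ s u → from (preserve-Sat φ) (Sat-cong φ (λ { zero → refl ; (suc i) → refl }) (s (fun u))))

    preserve-transitive : ∀ {t} → Transitive M t → Transitive M (fun t)
    preserve-transitive (st , tr) = (λ α → st (reflect-𝒜 α)) , λ y z y∈ z∈y →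
      subst (_∈ fun _) (involutive z) (preserve-∈ (tr (fun y) (fun z) (∈-fun y∈) (preserve-∈ z∈y)))

  module UrelementPermutation {π : U → U} (dπ : DefF π) (π-𝒜 : ∀ {a} → 𝒜 a → 𝒜 (π a))
                              (π-involutive : ∀ {a} → 𝒜 a → π (π a) ≡ a) where
    private
      G : U → U → U
      G x h with em {𝒜 x}
      ... | yes _ = π x
      ... | no _  = h

      G-𝒜 : ∀ {x h} → 𝒜 x → G x h ≡ π x
      G-𝒜 {x} α with em {𝒜 x}
      ... | yes _ = refl
      ... | no n  = ⊥-elim (n α)

      G-set : ∀ {x h} → Isset x → G x h ≡ h
      G-set {x} s with em {𝒜 x}
      ... | yes α = ⊥-elim (s α)
      ... | no _  = refl

      dG : DefF₂ G
      dG = F₂ $ mkT $ d⇔ (λ ρ → mk⇔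
             (λ { (inj₁ (α , e)) → trans e (sym (G-𝒜 α)) ; (inj₂ (s , e)) → trans e (sym (G-set s)) })
             (λ e → G-cases e em))
          (d⊎ (d× (d𝒜 v) (d≡ v (dπ ⟨$⟩ v))) (d× (disset v) (d≡ v v)))
        where
        G-cases : ∀ {a x h} → a ≡ G x h → Dec (𝒜 x) → 𝒜 x × a ≡ π x ⊎ Isset x × a ≡ h
        G-cases e (yes α) = inj₁ (α , trans e (G-𝒜 α))
        G-cases e (no s)  = inj₂ (s , trans e (G-set s))

    open ∈-Recursive (∈-recursion dG) renaming (fun to π̂; definable to dπ̂)

    π̂-𝒜 : ∀ {a} → 𝒜 a → π̂ a ≡ π a
    π̂-𝒜 α = trans (unfold _) (G-𝒜 α)

    π̂-set : ∀ {x} → Isset x → π̂ x ≡ img π̂ dπ̂ x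
    π̂-set s = trans (unfold _) (G-set s)

    private
      preserve : ∀ {x} → 𝒜 x → 𝒜 (π̂ x)
      preserve α = subst 𝒜 (sym (π̂-𝒜 α)) (π-𝒜 α)

      isset : ∀ {x} → Isset x → Isset (π̂ x)
      isset s = subst Isset (sym (π̂-set s)) img-set

      involutive : ∀ x → π̂ (π̂ x) ≡ x
      involutive = ∈-induction (mkR (d≡ (dπ̂ ⟨$⟩ (dπ̂ ⟨$⟩ v)) v)) λ x ih → case em {𝒜 x} of λ
        { (yes α) → trans (π̂-𝒜 (preserve α)) (trans (cong π (π̂-𝒜 α)) (π-involutive α))
        ; (no s)  → trans (π̂-set (isset s)) (trans (cong (img π̂ dπ̂) (π̂-set s)) (set-ext img-set s
            (λ z h → let (y , y∈ , e) = to ∈img h ; (w , w∈x , e') = to ∈img y∈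
                     in subst (_∈ x) (sym (trans e (trans (cong π̂ e') (ih w w∈x)))) w∈x)
            (λ z z∈x → from ∈img (π̂ z , from ∈img (z , z∈x , refl) , sym (ih z z∈x))))) }

    automorphism : Automorphism
    automorphism = record
      { fun = π̂
      ; involutive = involutive
      ; preserve-∈ = λ {x} {y} x∈y → subst (π̂ x ∈_) (sym (π̂-set (λ α → ur-empty α x∈y))) (from ∈img (x , x∈y , refl))
      ; preserve-𝒜 = preserve }

    π̂-fixes : ∀ {t} → Transitive M t → (∀ {a} → a ∈ t → 𝒜 a → π a ≡ a) → ∀ {z} → z ∈ t → π̂ z ≡ z
    π̂-fixes {t} (_ , tr) h {z} = ∈-induction {P = λ z → z ∈ t → π̂ z ≡ z} (mkR (d→ (d∈ v c) (d≡ (dπ̂ ⟨$⟩ v) v)))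
      (λ x ih x∈t → case em {𝒜 x} of λ
        { (yes α) → trans (π̂-𝒜 α) (h x∈t α)
        ; (no s)  → trans (π̂-set s) (set-ext img-set s
            (λ z k → let (y , y∈x , e) = to ∈img k in subst (_∈ x) (sym (trans e (ih y y∈x (tr x y x∈t y∈x)))) y∈x)
            (λ z z∈x → from ∈img (z , z∈x , sym (ih z z∈x (tr x z x∈t z∈x))))) }) z

  module Stages {A : U} (urset : IsUrSet M A) where
    private
      dG : DefF₂ (λ x h → A ∪ ⋃ (img 𝒫 (F₁ (t𝒫 v)) h))
      dG = F₂ (t∪ c (t⋃ (timg v)))

    open ∈-Recursive (∈-recursion dG) renaming (fun to stage; definable to dstage) public

    -- Arbitrary sets replace ordinals as indices: `stage x` is the level, at the rank of `x`, of
    -- the hierarchy that starts from `A`.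
    ∈stage : ∀ {x z} → z ∈ stage x ⇔ (z ∈ A ⊎ Σ U λ y → y ∈ x × Isset z × z ⊑ stage y)
    ∈stage {x} {z} = mk⇔
      (λ h → case to ∈∪ (subst (z ∈_) (unfold x) h) of λ
        { (inj₁ a) → inj₁ a
        ; (inj₂ a) → let (p , p∈ , z∈p) = to ∈⋃ a ; (s , s∈ , e) = to ∈img p∈ ; (y , y∈x , e') = to ∈img s∈
                     in inj₂ (y , y∈x , to ∈𝒫 (subst (z ∈_) (trans e (cong 𝒫 e')) z∈p)) })
      (λ h → subst (z ∈_) (sym (unfold x)) (case h of λ
        { (inj₁ a) → from ∈∪ (inj₁ a)
        ; (inj₂ (y , y∈x , s)) → from ∈∪ (inj₂ (from ∈⋃ (𝒫 (stage y) ,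
             from ∈img (stage y , from ∈img (y , y∈x , refl) , refl) , from ∈𝒫 s))) }))

    stage-set : ∀ {x} → Isset (stage x)
    stage-set {x} = subst Isset (sym (unfold x)) ⋃-set

    stage-transitive : ∀ x → Transitive M (stage x)
    stage-transitive x = stage-set , ∈-induction {P = λ x → ∀ u w → u ∈ stage x → w ∈ u → w ∈ stage x}
      (mkR (d∀ (d∀ (d→ (d∈ v (dstage ⟨$⟩ v)) (d→ (d∈ v v) (d∈ v (dstage ⟨$⟩ v)))))))
      (λ x ih u w u∈ w∈u → case to ∈stage u∈ of λ
        { (inj₁ a) → ⊥-elim (ur-empty (proj₂ urset u a) w∈u)
        ; (inj₂ (y , y∈x , su , u⊑)) → case em {𝒜 w} of λ
            { (no s)  → from ∈stage (inj₂ (y , y∈x , s , λ z z∈w → ih y y∈x w z (u⊑ w w∈u) z∈w))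
            ; (yes α) → case to ∈stage (u⊑ w w∈u) of λ
                { (inj₁ a) → from ∈stage (inj₁ a)
                ; (inj₂ (_ , _ , s , _)) → ⊥-elim (s α) } } }) x

    -- The alternatives render rank of `x` at most that of `y`, and rank of `y` below that of `x`.
    -- If `u` lies in `stage x` but not in `stage y`, then `u ⊑ stage x'` for some `x' ∈ x`. No
    -- `stage y'` with `y' ∈ y` includes `stage x'`, as `u` would then lie in `stage y`; the
    -- hypothesis at `x'` thus puts every `z ⊑ stage y` inside `stage x'`.
    stage-comparable : ∀ x y → stage x ⊑ stage y ⊎ (∀ z → Isset z → z ⊑ stage y → z ∈ stage x)
    stage-comparable = ∈-induction
      (mkR (d∀ (d⊎ (d⊑ (dstage ⟨$⟩ v) (dstage ⟨$⟩ v)) (d∀ (d→ (disset v) (d→ (d⊑ v (dstage ⟨$⟩ v)) (d∈ v (dstage ⟨$⟩ v))))))))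
      λ x ih y → case em {stage x ⊑ stage y} of λ
        { (yes i) → inj₁ i
        ; (no ¬i) → inj₂ λ z sz z⊑ → dne λ z∉ → ¬i λ u u∈ → dne λ u∉ → case to ∈stage u∈ of λ
            { (inj₁ a) → u∉ (from ∈stage (inj₁ a))
            ; (inj₂ (x' , x'∈x , su , u⊑)) → z∉ (from ∈stage (inj₂ (x' , x'∈x , sz , λ w w∈z →
                case to ∈stage (z⊑ w w∈z) of λ
                { (inj₁ a) → from ∈stage (inj₁ a)
                ; (inj₂ (y' , y'∈y , sw , w⊑)) → case ih x' x'∈x y' of λ
                    { (inj₁ i) → ⊥-elim (u∉ (from ∈stage (inj₂ (y' , y'∈y , su , λ q q∈u → i q (u⊑ q q∈u)))))
                    ; (inj₂ p) → p w sw w⊑ } }))) } }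

    -- A set is included in its own stage and becomes an element one level later, hence the
    -- singleton.
    stage-covers : ∀ {t} → Transitive M t → (∀ a → a ∈ t → 𝒜 a → a ∈ A) → ∀ {z} → z ∈ t → z ∈ stage (sg z)
    stage-covers {t} (_ , tr) h {z} z∈t = enter (from ∈sg refl) z∈t (sub z z∈t)
      where
      enter : ∀ {z x} → z ∈ x → z ∈ t → z ⊑ stage z → z ∈ stage x
      enter {z} z∈x z∈t i = case em {𝒜 z} of λ
        { (yes α) → from ∈stage (inj₁ (h z z∈t α))
        ; (no s)  → from ∈stage (inj₂ (z , z∈x , s , i)) }
      sub : ∀ z → z ∈ t → z ⊑ stage z
      sub = ∈-induction (mkR (d→ (d∈ v c) (d⊑ v (dstage ⟨$⟩ v)))) λ x ih x∈t y y∈x →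
        let y∈t = tr x y x∈t y∈x in enter y∈x y∈t (ih y y∈x y∈t)

    -- Stages are well-founded: when `stage x ⊑ stage y` fails, `stage y` is an element of
    -- `stage x`.
    least-stage : ∀ {Q} → DefR Q → (Σ U λ x → Q (stage x)) →
                  Σ U λ x → Q (stage x) × (∀ y → Q (stage y) → stage x ⊑ stage y)
    least-stage {Q} d (x , q) = dne λ none →
      ∈-induction {P = λ s → ¬ (Q s × Σ U λ x → s ≡ stage x)} (mkR (d¬ (d× (d $₁ v) (d∃ (d≡ v (dstage ⟨$⟩ v))))))
        (λ { _ ih (q , x , refl) → none (x , q , λ y q' → case stage-comparable x y of λ
              { (inj₁ i) → i
              ; (inj₂ p) → ⊥-elim (ih (stage y) (p (stage y) stage-set (λ _ k → k)) (q' , y , refl)) }) })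
        (stage x) (q , x , refl)

  -- Injections and well-orders

  opaque
    prod : U → U → U
    prod x y = ⋃ (img (λ a → img (op a) (F₁ (top c v)) y) (F₁ (set-valued (λ _ → img-set) (λ _ _ → ∈img)
      (d∃ (d× (d∈ v c) (d≡ v (top v v)))))) x)

    prod-set : ∀ {x y} → Isset (prod x y)
    prod-set = ⋃-set

    ∈prod : ∀ {x y p} → p ∈ prod x y ⇔ Σ U λ a → a ∈ x × Σ U λ b → b ∈ y × p ≡ op a b
    ∈prod = mk⇔
      (λ h → let (q , q∈ , p∈q) = to ∈⋃ h ; (a , a∈x , e) = to ∈img q∈
                 (b , b∈y , e') = to ∈img (subst (_ ∈_) e p∈q) in a , a∈x , b , b∈y , e')
      (λ (a , a∈x , b , b∈y , e) → from ∈⋃ (_ , from ∈img (a , a∈x , refl) , from ∈img (b , b∈y , e)))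

  tprod : ∀ {n} {f g : Env n → U} → DefT f → DefT g → DefT (λ ρ → prod (f ρ) (g ρ))
  tprod s t = set-valued (λ _ → prod-set) (λ _ _ → ∈prod)
    (d∃ (d× (d∈ v (weaken (weaken s))) (d∃ (d× (d∈ v (weaken (weaken (weaken t)))) (d≡ v (top v v))))))

  dRel : DefR₃ (Rel M)
  dRel = mkR₃ (d⇔ (λ _ → ⇔-sym Rel⇔) (d∈ (top v v) v))

  dIsOPair : DefR₃ (IsOPair M)
  dIsOPair = mkR₃ (d⇔ (λ _ → ⇔-sym IsOPair⇔) (d≡ v (top v v)))

  dInjects : DefR₂ (Injects M)
  dInjects = mkR₂ (d∃ (d× (d× (disset v) (d∀ (d→ (d∈ v v) (d∃ (d∃ (d× (d∈ v v) (d× (d∈ v v) (dIsOPair $₃ (v , v , v)))))))))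
    (d× (d∀ (d→ (d∈ v v) (d∃ (dRel $₃ (v , v , v)))))
    (d× (d∀ (d∀ (d∀ (d→ (dRel $₃ (v , v , v)) (d→ (dRel $₃ (v , v , v)) (d≡ v v))))))
        (d∀ (d∀ (d∀ (d→ (dRel $₃ (v , v , v)) (d→ (dRel $₃ (v , v , v)) (d≡ v v))))))))))

  dIsUrSet : DefR (IsUrSet M)
  dIsUrSet = mkR (d× (disset v) (d∀ (d→ (d∈ v v) (d𝒜 v))))

  dDisjoint : DefR₂ (Disjoint M)
  dDisjoint = mkR₂ (d∀ (d→ (d∈ v v) (d¬ (d∈ v v))))

  dIsTail : DefR₂ (IsTail M)
  dIsTail = mkR₂ (d× (dIsUrSet $₁ v) (d× (dDisjoint $₂ (v , v))
    (d∀ (d→ (dIsUrSet $₁ v) (d→ (dDisjoint $₂ (v , v)) (dInjects $₂ (v , v)))))))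

  infix 4 _↣_
  -- An injection is kept as a definable function on the whole universe, which makes composition
  -- immediate; Replacement recovers the set of pairs.
  record _↣_ (a b : U) : Set where
    field
      fun       : U → U
      definable : DefF fun
      maps      : ∀ {x} → x ∈ a → fun x ∈ b
      injective : ∀ {x y} → x ∈ a → y ∈ a → fun x ≡ fun y → x ≡ y
  open _↣_ public

  opaque
    fromInjects : ∀ {a b} → Injects M a b → a ↣ b
    fromInjects {a} {b} (f , (_ , on) , total , functional , inj) = record
        { fun = F ; definable = dthe unique (mkR₂ (dRel $₃ (c , v , v))) (F₁ v)
        ; maps = maps'
        ; injective = λ {x} {y} x∈a y∈a e → inj x y (F y) (subst (Rel M f x) e (graph x∈a)) (graph y∈a) }
      where
      unique : ∀ x y y' → Rel M f x y → Rel M f x y' → y ≡ y'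
      unique = functional
      F : U → U
      F = the (Rel M f) (λ x → x)
      graph : ∀ {x} → x ∈ a → Rel M f x (F x)
      graph {x} x∈a = let (y , r) = total x x∈a in subst (Rel M f x) (sym (the-spec unique r)) r
      maps' : ∀ {x} → x ∈ a → F x ∈ b
      maps' {x} x∈a = let (p , p∈f , op) = graph x∈a ; (x' , y' , _ , y'∈b , op') = on p p∈f in
        subst (_∈ b) (sym (op-injectiveʳ (trans (sym (to IsOPair⇔ op)) (to IsOPair⇔ op')))) y'∈b

  graphOf : ∀ {a b} → a ↣ b → U
  graphOf {a} i = img (λ x → op x (fun i x)) (F₁ (top v (definable i ⟨$⟩ v))) a

  graph-Rel : ∀ {a b} (i : a ↣ b) {x y} → Rel M (graphOf i) x y ⇔ (x ∈ a × y ≡ fun i x)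
  graph-Rel {a} i {x} {y} = mk⇔
    (λ r → let (u , u∈a , e) = to ∈img (to Rel⇔ r) in
       subst (_∈ a) (sym (op-injectiveˡ e)) u∈a ,
       trans (op-injectiveʳ e) (cong (fun i) (sym (op-injectiveˡ e))))
    (λ (x∈a , e) → from Rel⇔ (from ∈img (x , x∈a , cong (op x) e)))

  graph-injection : ∀ {a b} (i : a ↣ b) → IsInjection M (graphOf i) a b
  graph-injection i =
    (img-set , λ p p∈ → let (x , x∈a , e) = to ∈img p∈ in x , fun i x , x∈a , maps i x∈a , from IsOPair⇔ e) ,
    (λ x x∈a → fun i x , from (graph-Rel i) (x∈a , refl)) ,
    (λ x y y' r r' → trans (proj₂ (to (graph-Rel i) r)) (sym (proj₂ (to (graph-Rel i) r')))) ,
    λ x x' y r r' → let (x∈a , e) = to (graph-Rel i) r ; (x'∈a , e') = to (graph-Rel i) r' in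
      injective i x∈a x'∈a (trans (sym e) e')

  opaque
    toInjects : ∀ {a b} → a ↣ b → Injects M a b
    toInjects i = graphOf i , graph-injection i

  infixr 9 _⨾_
  _⨾_ : ∀ {a b c} → a ↣ b → b ↣ c → a ↣ c
  i ⨾ j = record
    { fun = λ x → fun j (fun i x)
    ; definable = F₁ (definable j ⟨$⟩ (definable i ⟨$⟩ v))
    ; maps = λ h → maps j (maps i h)
    ; injective = λ h k e → injective i h k (injective j (maps i h) (maps i k) e) }

  inclusion : ∀ {a b} → a ⊑ b → a ↣ b
  inclusion h = record { fun = λ x → x ; definable = F₁ v ; maps = h _ ; injective = λ _ _ e → e }

  rng : ∀ {a b} → a ↣ b → U
  rng {a} i = img (fun i) (definable i) a

  onto-rng : ∀ {a b} (i : a ↣ b) → a ↣ rng i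
  onto-rng i = record { fun = fun i ; definable = definable i ; maps = λ h → from ∈img (_ , h , refl) ; injective = injective i }

  rng-⊑ : ∀ {a b} (i : a ↣ b) → rng i ⊑ b
  rng-⊑ {b = b} i z h = let (x , x∈a , e) = to ∈img h in subst (_∈ b) (sym e) (maps i x∈a)

  opaque
    inverse : ∀ {a b} (i : a ↣ b) → rng i ↣ a
    inverse {a} i = record
        { fun = the R (λ x → x)
        ; definable = dthe unique (mkR₂ (d× (d∈ v c) (d≡ v (definable i ⟨$⟩ v)))) (F₁ v)
        ; maps = λ h → let (x , x∈a , e) = to ∈img h in subst (_∈ a) (sym (the-spec unique (x∈a , e))) x∈a
        ; injective = λ h k q → let (x , x∈a , e) = to ∈img h ; (x' , x'∈a , e') = to ∈img k in
            trans e (trans (cong (fun i) (trans (sym (the-spec unique (x∈a , e))) (trans q (the-spec unique (x'∈a , e'))))) (sym e')) }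
      where
      R : U → U → Set
      R y x = x ∈ a × y ≡ fun i x
      unique : ∀ y x x' → R y x → R y x' → x ≡ x'
      unique y x x' (h , e) (h' , e') = injective i h h' (trans (sym e) e')

  -- From plenitude to duplicates.

  opaque
    -- Each row of the product is a copy of `𝒫 a`, too large to be mapped into `a`. The diagonal set
    -- gives a definable point of the row that is sent outside `a`, so nothing has to be chosen; the
    -- first coordinate keeps the points of different rows apart.
    plenitude⁺⇒duplication : PlenitudePlus M → Duplication M
    plenitude⁺⇒duplication plenitude a urset-a with plenitude (prod a (𝒫 a)) prod-set
    ... | b , urset-b , f , f-inj , _ = rng g , (img-set , λ y h → proj₂ urset-b y (rng-⊑ g y h)) ,
          (λ z z∈a h → let (x , x∈a , e) = to ∈img h in outside x∈a (subst (_∈ a) e z∈a)) ,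
          graphOf g' , graph-injection g' ,
          λ y h → let (x , x∈a , e) = to ∈img h in x , from (graph-Rel g') (x∈a , e)
      where
      i : prod a (𝒫 a) ↣ b
      i = fromInjects (f , f-inj)
      Diag : U → U → Set
      Diag x z = Σ U λ s → s ∈ 𝒫 a × fun i (op x s) ≡ z × ¬ (z ∈ s)
      D : U → U
      D x = sep (Diag x) (mkR (d∃ (d× (d∈ v c) (d× (d≡ (definable i ⟨$⟩ top c v) v) (d¬ (d∈ v v)))))) a
      dD : DefF D
      dD = F₁ (set-valued (λ _ → sep-set) (λ _ _ → ∈sep)
        (d× (d∈ v c) (d∃ (d× (d∈ v c) (d× (d≡ (definable i ⟨$⟩ top v v) v) (d¬ (d∈ v v)))))))
      D∈𝒫 : ∀ {x} → D x ∈ 𝒫 a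
      D∈𝒫 = from ∈𝒫 (sep-set , λ z h → proj₁ (to ∈sep h))
      row : ∀ {x s} → x ∈ a → s ∈ 𝒫 a → op x s ∈ prod a (𝒫 a)
      row h k = from ∈prod (_ , h , _ , k , refl)
      val : U → U
      val x = fun i (op x (D x))
      outside : ∀ {x} → x ∈ a → ¬ (val x ∈ a)
      outside {x} x∈a h = ∉D (from ∈sep (h , D x , D∈𝒫 , refl , ∉D))
        where
        -- Membership yields some `s` with the same value as `D x` and without that value as an
        -- element; injectivity gives `s ≡ D x`, a contradiction.
        ∉D : ¬ (val x ∈ D x)
        ∉D k = let (_ , s , s∈ , e , ∉s) = to ∈sep k in
          ∉s (subst (val x ∈_) (sym (op-injectiveʳ (injective i (row x∈a s∈) (row x∈a D∈𝒫) e))) k)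
      g : a ↣ b
      g = record { fun = val ; definable = F₁ (definable i ⟨$⟩ top v (dD ⟨$⟩ v))
                 ; maps = λ h → maps i (row h D∈𝒫)
                 ; injective = λ h k e → op-injectiveˡ (injective i (row h D∈𝒫) (row k D∈𝒫) e) }
      g' : a ↣ rng g
      g' = onto-rng g

  -- Comparison of subsets of a well-ordered set.

  module WellOrder {r B : U} (wo : IsWellOrder M r B) where
    _≺_ : U → U → Set
    x ≺ y = op x y ∈ r

    d≺ : ∀ {n} {f g : Env n → U} → DefT f → DefT g → Def (λ ρ → f ρ ≺ g ρ)
    d≺ s t = d∈ (top s t) c

    ≺-irrefl : ∀ {x} → x ∈ B → ¬ (x ≺ x)
    ≺-irrefl x∈ h = proj₁ (proj₂ wo) _ x∈ (from Rel⇔ h)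

    ≺-trichotomy : ∀ {x y} → x ∈ B → y ∈ B → x ≺ y ⊎ (x ≡ y ⊎ y ≺ x)
    ≺-trichotomy x∈ y∈ with proj₁ (proj₂ (proj₂ (proj₂ wo))) _ _ x∈ y∈
    ... | inj₁ h        = inj₁ (to Rel⇔ h)
    ... | inj₂ (inj₁ e) = inj₂ (inj₁ e)
    ... | inj₂ (inj₂ h) = inj₂ (inj₂ (to Rel⇔ h))

    ≺-least : ∀ {P} → DefR P → ∀ {x} → x ∈ B → P x → Σ U λ m → m ∈ B × P m × (∀ z → z ∈ B → P z → ¬ (z ≺ m))
    ≺-least {P} d {x} x∈ p =
      let (m , m∈ , h) = proj₂ (proj₂ (proj₂ (proj₂ wo))) (sep P d B) sep-set (λ z k → proj₁ (to ∈sep k)) (x , from ∈sep (x∈ , p))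
          (m∈B , pm) = to ∈sep m∈
      in m , m∈B , pm , λ z z∈ pz z≺m → h z (from ∈sep (z∈ , pz)) (from Rel⇔ z≺m)

    seg : U → U → U
    seg W w = sep (λ z → z ≺ w) (mkR (d≺ v c)) W

    tseg : ∀ {n} {f g : Env n → U} → DefT f → DefT g → DefT (λ ρ → seg (f ρ) (g ρ))
    tseg s t = set-valued (λ _ → sep-set) (λ _ _ → ∈sep) (d× (d∈ v (weaken s)) (d≺ v (weaken t)))

    -- The order isomorphism between initial segments is the largest back-and-forth relation.
    module _ {X W : U} (X⊑ : X ⊑ B) (W⊑ : W ⊑ B) where
      private
        BackForth : U → Set
        BackForth f = ∀ x w → op x w ∈ f → x ∈ X × w ∈ W ×
          (∀ x' → x' ∈ X → x' ≺ x → Σ U λ w' → w' ∈ W × w' ≺ w × op x' w' ∈ f) ×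
          (∀ w' → w' ∈ W → w' ≺ w → Σ U λ x' → x' ∈ X × x' ≺ x × op x' w' ∈ f)

        _≈_ : U → U → Set
        x ≈ w = Σ U λ f → BackForth f × op x w ∈ f

        d≈ : DefR₂ _≈_
        d≈ = mkR₂ (d∃ (d× (d∀ (d∀ (d→ (d∈ (top v v) v) (d× (d∈ v c) (d× (d∈ v c) (d×
          (d∀ (d→ (d∈ v c) (d→ (d≺ v v) (d∃ (d× (d∈ v c) (d× (d≺ v v) (d∈ (top v v) v)))))))
          (d∀ (d→ (d∈ v c) (d→ (d≺ v v) (d∃ (d× (d∈ v c) (d× (d≺ v v) (d∈ (top v v) v))))))))))))) (d∈ (top v v) v)))

        ≈-∈ˡ : ∀ {x w} → x ≈ w → x ∈ X
        ≈-∈ˡ (f , h , m) = proj₁ (h _ _ m)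

        ≈-∈ʳ : ∀ {x w} → x ≈ w → w ∈ W
        ≈-∈ʳ (f , h , m) = proj₁ (proj₂ (h _ _ m))

        forth : ∀ {x w x'} → x ≈ w → x' ∈ X → x' ≺ x → Σ U λ w' → w' ∈ W × w' ≺ w × x' ≈ w'
        forth (f , h , m) x'∈ l = let (w' , w'∈ , l' , m') = proj₁ (proj₂ (proj₂ (h _ _ m))) _ x'∈ l in w' , w'∈ , l' , f , h , m'

        back : ∀ {x w w'} → x ≈ w → w' ∈ W → w' ≺ w → Σ U λ x' → x' ∈ X × x' ≺ x × x' ≈ w'
        back (f , h , m) w'∈ l = let (x' , x'∈ , l' , m') = proj₂ (proj₂ (proj₂ (h _ _ m))) _ w'∈ l in x' , x'∈ , l' , f , h , m'

        -- At the least `x` matched with both `w` and a larger `w'`, going back from `w` yields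
        -- `x' ≺ x` matched with `w`, and going forth from `x'` yields a second match of `x'` below
        -- `w`: a smaller fork.
        no-fork : ∀ {x w w'} → x ≈ w → x ≈ w' → ¬ (w ≺ w')
        no-fork {x} e e' l =
          let (m , _ , (w , w' , q , q' , w≺w') , min) = ≺-least {P = λ x → Σ U λ w → Σ U λ w' → x ≈ w × x ≈ w' × w ≺ w'}
                (mkR (d∃ (d∃ (d× (d≈ $₂ (v , v)) (d× (d≈ $₂ (v , v)) (d≺ v v)))))) (X⊑ _ (≈-∈ˡ e)) (_ , _ , e , e' , l)
              (x' , x'∈ , x'≺ , p) = back q' (≈-∈ʳ q) w≺w'
              (w'' , _ , w''≺ , p') = forth q x'∈ x'≺
          in min x' (X⊑ _ x'∈) (w'' , w , p' , p , w''≺) x'≺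

        ≈-functional : ∀ x w w' → x ≈ w → x ≈ w' → w ≡ w'
        ≈-functional x w w' e e' with ≺-trichotomy (W⊑ _ (≈-∈ʳ e)) (W⊑ _ (≈-∈ʳ e'))
        ... | inj₁ l        = ⊥-elim (no-fork e e' l)
        ... | inj₂ (inj₁ q) = q
        ... | inj₂ (inj₂ l) = ⊥-elim (no-fork e' e l)

        no-merge : ∀ {x x' w} → x ≈ w → x' ≈ w → ¬ (x ≺ x')
        no-merge e e' l = let (w' , w'∈ , l' , q) = forth e' (≈-∈ˡ e) l in
          ≺-irrefl (W⊑ _ (≈-∈ʳ e)) (subst (_≺ _) (≈-functional _ _ _ q e) l')

        ≈-injective : ∀ w x x' → x ≈ w → x' ≈ w → x ≡ x'
        ≈-injective w x x' e e' with ≺-trichotomy (X⊑ _ (≈-∈ˡ e)) (X⊑ _ (≈-∈ˡ e'))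
        ... | inj₁ l        = ⊥-elim (no-merge e e' l)
        ... | inj₂ (inj₁ q) = q
        ... | inj₂ (inj₂ l) = ⊥-elim (no-merge e' e l)

        Unmatchedʳ : U → Set
        Unmatchedʳ w = w ∈ W × ¬ (Σ U λ x → x ≈ w)

        Unmatchedˡ : U → Set
        Unmatchedˡ x = x ∈ X × ¬ (Σ U λ w → x ≈ w)

        dUnmatchedʳ : DefR Unmatchedʳ
        dUnmatchedʳ = mkR (d× (d∈ v c) (d¬ (d∃ (d≈ $₂ (v , v)))))

        dUnmatchedˡ : DefR Unmatchedˡ
        dUnmatchedˡ = mkR (d× (d∈ v c) (d¬ (d∃ (d≈ $₂ (v , v)))))

        belowʳ : ∀ {w x' w'} → Unmatchedʳ w → x' ≈ w' → w' ≺ w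
        belowʳ (w∈ , none) e with ≺-trichotomy (W⊑ _ (≈-∈ʳ e)) (W⊑ _ w∈)
        ... | inj₁ l           = l
        ... | inj₂ (inj₁ refl) = ⊥-elim (none (_ , e))
        ... | inj₂ (inj₂ l)    = ⊥-elim (none (let (x , _ , _ , q) = back e w∈ l in x , q))

        belowˡ : ∀ {x x' w'} → Unmatchedˡ x → x' ≈ w' → x' ≺ x
        belowˡ (x∈ , none) e with ≺-trichotomy (X⊑ _ (≈-∈ˡ e)) (X⊑ _ x∈)
        ... | inj₁ l           = l
        ... | inj₂ (inj₁ refl) = ⊥-elim (none (_ , e))
        ... | inj₂ (inj₂ l)    = ⊥-elim (none (let (w , _ , _ , q) = forth e x∈ l in w , q))

        -- The least unmatched points of the two sides could be matched with each other, since
        -- everything below them is matched already.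
        not-both : ∀ {x w} → Unmatchedˡ x → Unmatchedʳ w → ⊥
        not-both ux uw =
          let (x , _ , ux , minx) = ≺-least dUnmatchedˡ (X⊑ _ (proj₁ ux)) ux
              (w , _ , uw , minw) = ≺-least dUnmatchedʳ (W⊑ _ (proj₁ uw)) uw
          in proj₂ ux (w , extended x w ux minx uw minw)
          where
          extended : ∀ x w → Unmatchedˡ x → (∀ z → z ∈ B → Unmatchedˡ z → ¬ (z ≺ x)) →
                     Unmatchedʳ w → (∀ z → z ∈ B → Unmatchedʳ z → ¬ (z ≺ w)) → x ≈ w
          extended x w ux minx uw minw = f , bf , from ∈∪ (inj₂ (from ∈sg refl))
            where
            dmatched : DefR (λ p → Σ U λ x → Σ U λ w → p ≡ op x w × x ≈ w)
            dmatched = mkR (d∃ (d∃ (d× (d≡ v (top v v)) (d≈ $₂ (v , v)))))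
            f = sep _ dmatched (prod X W) ∪ sg (op x w)
            f-in : ∀ {x w} → x ≈ w → op x w ∈ f
            f-in e = from ∈∪ (inj₁ (from ∈sep (from ∈prod (_ , ≈-∈ˡ e , _ , ≈-∈ʳ e , refl) , _ , _ , refl , e)))
            f-out : ∀ {x' w'} → op x' w' ∈ f → x' ≈ w' ⊎ x' ≡ x × w' ≡ w
            f-out h with to ∈∪ h
            ... | inj₂ k = inj₂ (op-injectiveˡ (to ∈sg k) , op-injectiveʳ (to ∈sg k))
            ... | inj₁ k = let (_ , x' , w' , e , q) = to ∈sep k in
              inj₁ (subst₂ _≈_ (sym (op-injectiveˡ e)) (sym (op-injectiveʳ e)) q)
            bf : BackForth f
            bf x' w' h with f-out h
            ... | inj₁ e = ≈-∈ˡ e , ≈-∈ʳ e ,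
              (λ y y∈ l → let (w , w∈ , l' , q) = forth e y∈ l in w , w∈ , l' , f-in q) ,
              (λ y y∈ l → let (w , w∈ , l' , q) = back e y∈ l in w , w∈ , l' , f-in q)
            ... | inj₂ (refl , refl) = proj₁ ux , proj₁ uw ,
              (λ y y∈ l → let (w , q) = dne (λ n → minx y (X⊑ _ y∈) (y∈ , n) l) in w , ≈-∈ʳ q , belowʳ uw q , f-in q) ,
              (λ y y∈ l → let (w , q) = dne (λ n → minw y (W⊑ _ y∈) (y∈ , n) l) in w , ≈-∈ˡ q , belowˡ ux q , f-in q)

      opaque
        -- If all of `W` is matched, the inverse matching is an injection into `X`. Otherwise all of
        -- `X` is matched, and its partners lie below any unmatched `w`.
        injection-or-segment : (W ↣ X) ⊎ Σ U λ w → w ∈ W × X ↣ seg W w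
        injection-or-segment with em {Σ U Unmatchedʳ}
        ... | no none = inj₁ record
          { fun = the (λ w x → x ≈ w) (λ x → x)
          ; definable = dthe ≈-injective (mkR₂ (d≈ $₂ (v , v))) (F₁ v)
          ; maps = λ h → ≈-∈ˡ (matched h)
          ; injective = λ {w} {w'} h k e → ≈-functional _ _ _ (matched h) (subst (_≈ w') (sym e) (matched k)) }
          where
          matched : ∀ {w} → w ∈ W → the (λ w x → x ≈ w) (λ x → x) w ≈ w
          matched {w} h = let (x , q) = dne (λ n → none (w , h , n)) in subst (_≈ w) (sym (the-spec ≈-injective q)) q
        ... | yes (w , uw) = inj₂ (w , proj₁ uw , record
          { fun = the _≈_ (λ x → x)
          ; definable = dthe ≈-functional d≈ (F₁ v)
          ; maps = λ h → from ∈sep (≈-∈ʳ (matched h) , belowʳ uw (matched h))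
          ; injective = λ {x} {x'} h k e → ≈-injective _ _ _ (matched h) (subst (x' ≈_) (sym e) (matched k)) })
          where
          matched : ∀ {x} → x ∈ X → x ≈ the _≈_ (λ x → x) x
          matched {x} h = let (w , q) = dne (λ n → not-both (h , n) uw) in subst (x ≈_) (sym (the-spec ≈-functional q)) q

  -- Tails

  urset-∪ : ∀ {a b} → IsUrSet M a → IsUrSet M b → IsUrSet M (a ∪ b)
  urset-∪ (_ , h) (_ , k) = ⋃-set , λ y y∈ → [ h y , k y ]′ (to ∈∪ y∈)

  opaque
    tail-↣ : ∀ {a b e} → IsTail M a b → IsUrSet M e → (∀ z → z ∈ e → ¬ (z ∈ a)) → e ↣ b
    tail-↣ (_ , _ , h) ue dis = fromInjects (h _ ue dis)

  record MinimalTail (K₀ : U) : Set where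
    field
      {K B}  : U
      urset  : IsUrSet M K
      K₀⊑K   : K₀ ⊑ K
      tail   : IsTail M K B
      minimal : ∀ {K' B'} → IsUrSet M K' → K ⊑ K' → IsTail M K' B' → B ↣ B'

  opaque
    -- Tails of supersets of `K₀` are disjoint from `K₀` and so inject into `B₀`; their sizes are
    -- measured by initial segments of `B₀`. The least segment that admits some such tail, or all of
    -- `B₀` when no proper one does, provides `K` and `B`.
    minimal-tail : TailPlus M → ∀ {K₀} → IsUrSet M K₀ → MinimalTail K₀
    minimal-tail tailPlus {K₀} uK₀ with tailPlus K₀ uK₀
    ... | B₀ , tail₀ , r , wo = build (em {Σ U λ w → w ∈ B₀ × Small w})
      where
      open WellOrder wo
      Small : U → Set
      Small w = Σ U λ K → Σ U λ B → IsUrSet M K × K₀ ⊑ K × IsTail M K B × Injects M B (seg B₀ w)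
      dSmall : DefR Small
      dSmall = mkR (d∃ (d∃ (d× (dIsUrSet $₁ v) (d× (d⊑ c v) (d× (dIsTail $₂ (v , v)) (dInjects $₂ (v , tseg c v)))))))
      finish : ∀ {K B W} → IsUrSet M K → K₀ ⊑ K → IsTail M K B → W ⊑ B₀ → B ↣ W →
               (∀ w → w ∈ W → ¬ Small w) → MinimalTail K₀
      finish {K} {B} {W} uK K₀⊑K tail W⊑ i ¬small = record
        { urset = uK ; K₀⊑K = K₀⊑K ; tail = tail
        ; minimal = λ {K'} {B'} uK' K⊑K' tail' →
            let j = tail-↣ tail (proj₁ tail') (λ z z∈B' z∈K → proj₁ (proj₂ tail') z (K⊑K' z z∈K) z∈B') ⨾ i
            -- The copy of `B'` inside `W` is compared with `W` itself. Were it to fit into a proper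
            -- segment, `B'` would contradict the minimality of `W`; otherwise `B` embeds through
            -- `W` into that copy.
            in case injection-or-segment (λ z h → W⊑ z (rng-⊑ j z h)) W⊑ of λ
              { (inj₁ k) → i ⨾ k ⨾ inverse j
              ; (inj₂ (w , w∈ , k)) → ⊥-elim (¬small w w∈ (K' , B' , uK' , (λ z h → K⊑K' z (K₀⊑K z h)) , tail' ,
                  toInjects (onto-rng j ⨾ k ⨾ inclusion (λ z h → from ∈sep (W⊑ z (proj₁ (to ∈sep h)) , proj₂ (to ∈sep h)))))) } }
      build : Dec (Σ U λ w → w ∈ B₀ × Small w) → MinimalTail K₀
      build (no none) = finish uK₀ (λ _ h → h) tail₀ (λ _ h → h) (inclusion (λ _ h → h)) (λ w w∈ s → none (w , w∈ , s))
      build (yes (w , w∈ , s)) =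
        let (w , _ , (K , B , uK , K₀⊑K , tail , i) , min) = ≺-least dSmall w∈ s
        in finish uK K₀⊑K tail (λ z h → proj₁ (to ∈sep h)) (fromInjects i)
             (λ z h s → min z (proj₁ (to ∈sep h)) s (proj₂ (to ∈sep h)))

  -- Exchanges of urelements.

  urelementsOutside : U → U → U
  urelementsOutside A = sep (λ a → 𝒜 a × ¬ (a ∈ A)) (mkR (d× (d𝒜 v) (d¬ (d∈ v c))))

  SupportedBy : U → U → Set
  SupportedBy A z = Σ U λ t → Transitive M t × z ∈ t × (∀ a → a ∈ t → 𝒜 a → a ∈ A)

  dTransitive : DefR (Transitive M)
  dTransitive = mkR (d× (disset v) (d∀ (d∀ (d→ (d∈ v v) (d→ (d∈ v v) (d∈ v v))))))

  dSupportedBy : DefR₂ SupportedBy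
  dSupportedBy = mkR₂ (d∃ (d× (dTransitive $₁ v) (d× (d∈ v v) (d∀ (d→ (d∈ v v) (d→ (d𝒜 v) (d∈ v v)))))))

  record Displacement (t A D : U) : Set where
    field
      automorphism : Automorphism
    open Automorphism automorphism public renaming (fun to permute)
    field
      fixes   : ∀ {z} → SupportedBy A z → permute z ≡ z
      support : ∀ {a} → a ∈ permute t → 𝒜 a → a ∈ A ⊎ a ∈ D

  module _ {t A D : U} (uD : IsUrSet M D) (D∩A : Disjoint M D A) (D∩t : Disjoint M D t)
           (i : urelementsOutside A t ↣ D) where
    private
      E = urelementsOutside A t

      -- The set `E` is exchanged with its image in `D`. As `E ⊑ t` and `D` avoids `t`, the two are
      -- disjoint, which makes the exchange a well-defined involution.
      Swap : U → U → Set
      Swap x y = (x ∈ E × y ≡ fun i x) ⊎ (y ∈ E × x ≡ fun i y)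

      dSwap : DefR₂ Swap
      dSwap = mkR₂ (d⊎ (d× (d∈ v c) (d≡ v (definable i ⟨$⟩ v))) (d× (d∈ v c) (d≡ v (definable i ⟨$⟩ v))))

      Swap-sym : ∀ {x y} → Swap x y → Swap y x
      Swap-sym (inj₁ h) = inj₂ h
      Swap-sym (inj₂ h) = inj₁ h

      E∩D : ∀ {x y} → x ∈ E → y ∈ E → ¬ (x ≡ fun i y)
      E∩D h k e = D∩t _ (maps i k) (subst (_∈ t) e (proj₁ (to ∈sep h)))

      Swap-unique : ∀ x y y' → Swap x y → Swap x y' → y ≡ y'
      Swap-unique x y y' (inj₁ (_ , e)) (inj₁ (_ , e')) = trans e (sym e')
      Swap-unique x y y' (inj₁ (h , _)) (inj₂ (k , e')) = ⊥-elim (E∩D h k e')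
      Swap-unique x y y' (inj₂ (h , e)) (inj₁ (k , _))  = ⊥-elim (E∩D k h e)
      Swap-unique x y y' (inj₂ (h , e)) (inj₂ (k , e')) = injective i h k (trans (sym e) e')

      Swap-𝒜 : ∀ {x y} → Swap x y → 𝒜 y
      Swap-𝒜 (inj₁ (h , refl)) = proj₂ uD _ (maps i h)
      Swap-𝒜 (inj₂ (h , _))    = proj₁ (proj₂ (to ∈sep h))

      π : U → U
      π = the Swap (λ x → x)

      dπ : DefF π
      dπ = dthe Swap-unique dSwap (F₁ v)

      π-Swap : ∀ {x y} → Swap x y → π x ≡ y
      π-Swap = the-spec Swap-unique

      π-𝒜 : ∀ {a} → 𝒜 a → 𝒜 (π a)
      π-𝒜 {a} α with em {Σ U (Swap a)}
      ... | yes (y , s) = subst 𝒜 (sym (π-Swap s)) (Swap-𝒜 s)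
      ... | no n        = subst 𝒜 (sym (the-default n)) α

      π-involutive : ∀ {a} → 𝒜 a → π (π a) ≡ a
      π-involutive {a} α with em {Σ U (Swap a)}
      ... | yes (y , s) = trans (cong π (π-Swap s)) (π-Swap (Swap-sym s))
      ... | no n        = trans (cong π (the-default n)) (the-default n)

      π-fixes : ∀ {a} → a ∈ A → π a ≡ a
      π-fixes a∈A = the-default λ
        { (_ , inj₁ (h , _))    → proj₂ (proj₂ (to ∈sep h)) a∈A
        ; (_ , inj₂ (h , refl)) → D∩A _ (maps i h) a∈A }

      module P = UrelementPermutation dπ π-𝒜 π-involutive
      open Automorphism P.automorphism using (∈-fun)

    opaque
      displacement : Displacement t A D
      displacement = record
        { automorphism = P.automorphism
        ; fixes = λ (s , tr , z∈s , h) → P.π̂-fixes tr (λ a∈s α → π-fixes (h _ a∈s α)) z∈s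
        ; support = λ {a} a∈ α →
            -- An urelement `a` of the displaced set is the image of `π a ∈ t`. Either `π a` lies in
            -- `A` and is fixed, or it lies in `E` and is sent into `D`.
            let πa∈t = subst (_∈ t) (P.π̂-𝒜 α) (∈-fun a∈)
            in case em {π a ∈ A} of λ
              { (yes h) → inj₁ (subst (_∈ A) (trans (sym (π-fixes h)) (π-involutive α)) h)
              ; (no h)  → let πa∈E = from ∈sep (πa∈t , π-𝒜 α , h) in
                  inj₂ (subst (_∈ D) (trans (sym (π-Swap (inj₁ (πa∈E , refl)))) (π-involutive α)) (maps i πa∈E)) } }

  -- An elementary class with boundedly many urelements.

  record ElementaryClass (t₀ : U) : Set₁ where
    field
      Member      : U → Set
      dMember     : DefR Member
      transitive  : ∀ {y z} → Member y → z ∈ y → Member z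
      {A}         : U
      urset       : IsUrSet M A
      supported   : ∀ {z} → Member z → SupportedBy A z
      contains    : ∀ {z} → z ∈ t₀ → Member z
      -- This is the Tarski-Vaught criterion for the class.
      witness     : ∀ {n} (φ : Formula (suc n)) {ρ : Env n} → (∀ i → Member (ρ i)) →
                    ∀ {u} → Sat M φ (ext M u ρ) → Σ U λ u' → Member u' × Sat M φ (ext M u' ρ)

  module _ (tailPlus : TailPlus M) {t₀ : U} (tr₀ : Transitive M t₀) where
    private
      dUrelement : DefR 𝒜
      dUrelement = mkR (d𝒜 v)

      K₀ = sep 𝒜 dUrelement t₀

      uK₀ : IsUrSet M K₀
      uK₀ = sep-set , λ y h → proj₂ (to ∈sep h)

      open MinimalTail (minimal-tail tailPlus uK₀) renaming (urset to uK)

      uB : IsUrSet M B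
      uB = proj₁ tail

      B∩K : ∀ {z} → z ∈ B → ¬ (z ∈ K)
      B∩K z∈B z∈K = proj₁ (proj₂ tail) _ z∈K z∈B

      tailOfK∪B = tailPlus (K ∪ B) (urset-∪ uK uB)
      D = proj₁ tailOfK∪B

      tailD : IsTail M (K ∪ B) D
      tailD = proj₁ (proj₂ tailOfK∪B)

      opaque
        B∪D↣B : (B ∪ D) ↣ B
        B∪D↣B = tail-↣ tail (urset-∪ uB (proj₁ tailD)) λ z h z∈K → case to ∈∪ h of λ
          { (inj₁ z∈B) → B∩K z∈B z∈K
          ; (inj₂ z∈D) → proj₁ (proj₂ tailD) z (from ∈∪ (inj₁ z∈K)) z∈D }

      -- `B ∪ D` is disjoint from `K` and hence injects into the tail `B`, while minimality puts a
      -- copy of `B` inside `D`. Restricting the injection to `B` and to this copy gives two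
      -- self-injections with disjoint ranges.
      i₀ i₁ : B ↣ B
      i₀ = inclusion (λ z h → from ∈∪ (inj₁ h)) ⨾ B∪D↣B
      i₁ = minimal (urset-∪ uK uB) (λ z h → from ∈∪ (inj₁ h)) tailD ⨾ inclusion (λ z h → from ∈∪ (inj₂ h)) ⨾ B∪D↣B

      i₁∉i₀ : ∀ {x y} → x ∈ B → y ∈ B → ¬ (fun i₁ x ≡ fun i₀ y)
      i₁∉i₀ {x} {y} x∈ y∈ e =
        let j = minimal (urset-∪ uK uB) (λ z h → from ∈∪ (inj₁ h)) tailD
            q = injective B∪D↣B (from ∈∪ (inj₂ (maps j x∈))) (from ∈∪ (inj₁ y∈)) e
        in proj₁ (proj₂ tailD) _ (from ∈∪ (inj₂ y∈)) (subst (_∈ D) q (maps j x∈))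

      -- Inside `B`, the complement of `A` is replaced by its image under `i₀`. Starting from `K`,
      -- the complements are `B`, the range of `i₀`, the range of its square, and so on. Each
      -- difference of successive sets is a shifted copy of the part of `B` outside the range of
      -- `i₀`, and thus contains a shifted range of `i₁`.
      G : U → U
      G A = K ∪ (B ∖ img (fun i₀) (definable i₀) (B ∖ A))

      dG : DefF G
      dG = F₁ (t∪ c (t∖ c (timg (t∖ c v))))

      open Iterates (iterate dG K) renaming (carrier to 𝔸)

      G-mono : ∀ {x y} → x ⊑ y → G x ⊑ G y
      G-mono x⊑y z h = case to ∈∪ h of λ
        { (inj₁ k) → from ∈∪ (inj₁ k)
        ; (inj₂ k) → let (z∈B , z∉) = to ∈∖ k in from ∈∪ (inj₂ (from ∈∖ (z∈B , λ l →
            let (u , u∈ , e) = to ∈img l ; (u∈B , u∉y) = to ∈∖ u∈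
            in z∉ (from ∈img (u , from ∈∖ (u∈B , λ u∈x → u∉y (x⊑y u u∈x)) , e))))) }

      K⊑G : ∀ {A} → K ⊑ G A
      K⊑G z h = from ∈∪ (inj₁ h)

      G⊑K∪B : ∀ {A} → G A ⊑ K ∪ B
      G⊑K∪B z h = case to ∈∪ h of λ { (inj₁ k) → from ∈∪ (inj₁ k) ; (inj₂ k) → from ∈∪ (inj₂ (proj₁ (to ∈∖ k))) }

      Good : U → Set
      Good A = A ⊑ K ∪ B × K ⊑ A × A ⊑ G A × Injects M B (G A ∖ A)

      dGood : DefR Good
      dGood = mkR (d× (d⊑ v c) (d× (d⊑ c v) (d× (d⊑ v (dG ⟨$⟩ v)) (dInjects $₂ (c , t∖ (dG ⟨$⟩ v) v)))))

      opaque
        good : ∀ {A} → A ∈ 𝔸 → Good A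
        good = induction dGood
          ((λ z h → from ∈∪ (inj₁ h)) , (λ z h → h) , K⊑G , toInjects (record
            { fun = fun i₁ ; definable = definable i₁ ; injective = injective i₁
            ; maps = λ x∈ → from ∈∖ (from ∈∪ (inj₂ (from ∈∖ (maps i₁ x∈ , λ h →
                let (y , y∈ , e) = to ∈img h in i₁∉i₀ x∈ (proj₁ (to ∈∖ y∈)) e))) , B∩K (maps i₁ x∈)) }))
          λ A _ (A⊑ , K⊑A , A⊑G , j) → G⊑K∪B , K⊑G , G-mono A⊑G , toInjects (fromInjects j ⨾ shift K⊑A)
          where
          shift : ∀ {A} → K ⊑ A → G A ∖ A ↣ G (G A) ∖ G A
          shift {A} K⊑A = record
              { fun = fun i₀ ; definable = definable i₀
              ; injective = λ h k → injective i₀ (inB h) (inB k)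
              ; maps = λ {x} h → from ∈∖
                  ( from ∈∪ (inj₂ (from ∈∖ (maps i₀ (inB h) , λ k →
                      let (y , y∈ , e) = to ∈img k ; (y∈B , y∉G) = to ∈∖ y∈
                      in y∉G (subst (_∈ G A) (injective i₀ (inB h) y∈B e) (proj₁ (to ∈∖ h))))))
                  , λ k → case to ∈∪ k of λ
                      { (inj₁ l) → B∩K (maps i₀ (inB h)) l
                      ; (inj₂ l) → proj₂ (to ∈∖ l) (from ∈img (x , from ∈∖ (inB h , proj₂ (to ∈∖ h)) , refl)) }) }
            where
            inB : ∀ {x} → x ∈ (G A ∖ A) → x ∈ B
            inB h = let (x∈G , x∉A) = to ∈∖ h in case to ∈∪ x∈G of λ
              { (inj₁ x∈K) → ⊥-elim (x∉A (K⊑A _ x∈K)) ; (inj₂ k) → proj₁ (to ∈∖ k) }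

      urset-𝔸 : ∀ {A} → A ⊑ K ∪ B → ∀ y → y ∈ A → 𝒜 y
      urset-𝔸 A⊑ y h = proj₂ (urset-∪ uK uB) y (A⊑ y h)

      -- An exchange needs a target disjoint from `t`, but `t` may already meet the part of `G A`
      -- outside `A`. The detour through `B*`, which avoids both `t` and `K ∪ B`, clears that part
      -- first.
      move : ∀ {A} → A ∈ 𝔸 → ∀ {n} (φ : Formula (suc n)) {ρ : Env n} → (∀ i → SupportedBy A (ρ i)) →
             ∀ {u} → Sat M φ (ext M u ρ) → Σ U λ u' → SupportedBy (G A) u' × Sat M φ (ext M u' ρ)
      move {A} A∈𝔸 φ {ρ} sup {u} s =
        α₂.permute (α₁.permute u) ,
        (α₂.permute (α₁.permute t) , α₂.preserve-transitive (α₁.preserve-transitive tr) , α₂.preserve-∈ (α₁.preserve-∈ u∈t) ,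
          λ a a∈ α → [ A⊑G a , (λ h → proj₁ (to ∈∖ h)) ]′ (α₂.support a∈ α)) ,
        Sat-cong φ (λ { zero → refl ; (suc i) → trans (cong α₂.permute (α₁.fixes (sup i))) (α₂.fixes (sup i)) })
          (to (α₂.preserve-Sat φ) (to (α₁.preserve-Sat φ) s))
        where
        g = good A∈𝔸
        K⊑A = proj₁ (proj₂ g)
        A⊑G = proj₁ (proj₂ (proj₂ g))
        B↣G∖A : B ↣ G A ∖ A
        B↣G∖A = fromInjects (proj₂ (proj₂ (proj₂ g)))
        T = transitive-containing u
        t = proj₁ T
        tr = proj₁ (proj₂ T)
        u∈t = proj₂ (proj₂ T)
        outside : ∀ {s} → urelementsOutside A s ↣ B
        outside = tail-↣ tail (sep-set , λ y h → proj₁ (proj₂ (to ∈sep h)))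
          λ z h z∈K → proj₂ (proj₂ (to ∈sep h)) (K⊑A z z∈K)
        K' = (K ∪ B) ∪ sep 𝒜 dUrelement t
        uK' : IsUrSet M K'
        uK' = urset-∪ (urset-∪ uK uB) (sep-set , λ y h → proj₂ (to ∈sep h))
        B* = proj₁ (tailPlus K' uK')
        tail* : IsTail M K' B*
        tail* = proj₁ (proj₂ (tailPlus K' uK'))
        B*∩ : ∀ {z} → z ∈ B* → ¬ (z ∈ (K ∪ B))
        B*∩ h k = proj₁ (proj₂ tail*) _ (from ∈∪ (inj₁ k)) h
        δ₁ : Displacement t A B*
        δ₁ = displacement (proj₁ tail*)
          (λ z h k → B*∩ h (proj₁ g z k))
          (λ z h k → proj₁ (proj₂ tail*) z (from ∈∪ (inj₂ (from ∈sep (k , proj₂ (proj₁ tail*) z h)))) h)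
          -- The urelements to be moved belong to `K'`, so the tail property of `B*` does not apply
          -- to them. They avoid `K`, hence inject into `B`, and minimality carries `B` into `B*`.
          (outside ⨾ minimal uK' (λ z h → from ∈∪ (inj₁ (from ∈∪ (inj₁ h)))) tail*)
        module α₁ = Displacement δ₁
        δ₂ : Displacement (α₁.permute t) A (G A ∖ A)
        δ₂ = displacement
          (∖-set , λ y h → urset-𝔸 G⊑K∪B y (proj₁ (to ∈∖ h)))
          (λ z h → proj₂ (to ∈∖ h))
          -- After the first exchange the urelements lie in `A` or `B*`, and `B*` avoids `K ∪ B`,
          -- which includes `G A`.
          (λ z h k → let (z∈G , z∉A) = to ∈∖ h in
            [ z∉A , (λ z∈B* → B*∩ z∈B* (G⊑K∪B z z∈G)) ]′ (α₁.support k (urset-𝔸 G⊑K∪B z z∈G)))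
          (outside ⨾ B↣G∖A)
        module α₂ = Displacement δ₂

      Member : U → Set
      Member z = Σ U λ A → A ∈ 𝔸 × SupportedBy A z

      enlarge : ∀ {A A' z} → A ⊑ A' → SupportedBy A z → SupportedBy A' z
      enlarge A⊑ (t , tr , z∈t , h) = t , tr , z∈t , λ a a∈ α → A⊑ a (h a a∈ α)

      common : ∀ {n} {ρ : Env n} → (∀ i → Member (ρ i)) → Σ U λ A → A ∈ 𝔸 × (∀ i → SupportedBy A (ρ i))
      common {zero} m = K , base , λ ()
      common {suc n} m with m zero | common (λ i → m (suc i))
      ... | A , A∈ , h | A' , A'∈ , h' with chain G-mono K⊑G A∈ A'∈
      ...   | inj₁ A⊑A' = A' , A'∈ , λ { zero → enlarge A⊑A' h ; (suc i) → h' i }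
      ...   | inj₂ A'⊑A = A , A∈ , λ { zero → h ; (suc i) → enlarge A'⊑A (h' i) }

    opaque
      elementary-class : ElementaryClass t₀
      elementary-class = record
        { Member = Member
        ; dMember = mkR (d∃ (d× (d∈ v c) (dSupportedBy $₂ (v , v))))
        ; transitive = λ (A , A∈ , t , tr , y∈t , h) z∈y → A , A∈ , t , tr , proj₂ tr _ _ y∈t z∈y , h
        ; urset = ⋃-set {𝔸} , λ y h → let (A , A∈ , y∈A) = to ∈⋃ h in urset-𝔸 (proj₁ (good A∈)) y y∈A
        ; supported = λ (A , A∈ , s) → enlarge (λ z h → from ∈⋃ (A , A∈ , h)) s
        ; contains = λ {z} z∈t₀ → K , base , t₀ , tr₀ , z∈t₀ , λ a a∈ α → K₀⊑K a (from ∈sep (a∈ , α))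
        ; witness = λ φ m s → let (A , A∈ , sup) = common m ; (u' , su , s') = move A∈ φ sup s in
            u' , (G A , step A∈ , su) , s' }

  -- Reflection

  private
    First Second : U → U → Set
    First p x = Σ U λ y → p ≡ op x y
    Second p y = Σ U λ x → p ≡ op x y

    First-unique : ∀ p x x' → First p x → First p x' → x ≡ x'
    First-unique p x x' (_ , e) (_ , e') = op-injectiveˡ (trans (sym e) e')

    Second-unique : ∀ p x x' → Second p x → Second p x' → x ≡ x'
    Second-unique p x x' (_ , e) (_ , e') = op-injectiveʳ (trans (sym e) e')

    first second : U → U
    first  = the First (λ p → p)
    second = the Second (λ p → p)

    dfirst : DefF first
    dfirst = dthe First-unique (mkR₂ (d∃ (d≡ v (top v v)))) (F₁ v)

    dsecond : DefF second
    dsecond = dthe Second-unique (mkR₂ (d∃ (d≡ v (top v v)))) (F₁ v)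

  -- Coding environments by nested pairs collects all environments over `s` into one set, to which
  -- Replacement applies.
  tuples : ℕ → U → U
  tuples zero    s = sg ∅
  tuples (suc n) s = prod s (tuples n s)

  ttuples : ∀ n {m} {f : Env m → U} → DefT f → DefT (λ ρ → tuples n (f ρ))
  ttuples zero    t = c
  ttuples (suc n) t = tprod t (ttuples n t)

  tuples-mono : ∀ n {s s'} → s ⊑ s' → tuples n s ⊑ tuples n s'
  tuples-mono zero    i z h = h
  tuples-mono (suc n) i z h = let (a , a∈ , b , b∈ , e) = to ∈prod h in
    from ∈prod (a , i a a∈ , b , tuples-mono n i b b∈ , e)

  component : ∀ {n} → Fin n → U → U
  component zero    p = first p
  component (suc i) p = component i (second p)

  tcomponent : ∀ {n} (i : Fin n) {m} {f : Env m → U} → DefT f → DefT (λ ρ → component i (f ρ))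
  tcomponent zero    t = dfirst ⟨$⟩ t
  tcomponent (suc i) t = tcomponent i (dsecond ⟨$⟩ t)

  encode : ∀ {n s} {ρ : Env n} → (∀ i → ρ i ∈ s) → Σ U λ p → p ∈ tuples n s × (∀ i → component i p ≡ ρ i)
  encode {zero}  h = ∅ , from ∈sg refl , λ ()
  encode {suc n} {s} {ρ} h = let (p , p∈ , e) = encode (λ i → h (suc i)) in
    op (ρ zero) p , from ∈prod (ρ zero , h zero , p , p∈ , refl) , λ
      { zero    → the-spec First-unique (p , refl)
      ; (suc i) → trans (cong (component i) (the-spec Second-unique (ρ zero , refl))) (e i) }

  module _ {t₀ : U} (tr₀ : Transitive M t₀) (E : ElementaryClass t₀) where
    open ElementaryClass E
    open Stages urset

    private
      module _ {n} (ψ : Formula (suc n)) where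
        Counterexample : U → U → Set
        Counterexample p u = ¬ Sat M ψ (ext M u (λ i → component i p))

        dCounterexample : DefR₂ Counterexample
        dCounterexample = mkR₂ (d¬ (d⇔
            (λ ρ → mk⇔ (Sat-cong ψ λ { zero → refl ; (suc i) → refl }) (Sat-cong ψ λ { zero → refl ; (suc i) → refl }))
            (dSat ψ {f} λ { zero → v ; (suc i) → tcomponent i v })))
          where
          f : Fin (suc n) → Env 2 → U
          f zero    ρ = ρ (suc zero)
          f (suc i) ρ = component i (ρ zero)

        Meets : U → U → Set
        Meets p s = Σ U λ u → u ∈ s × Member u × Counterexample p u

        dMeets : DefR₂ Meets
        dMeets = mkR₂ (d∃ (d× (d∈ v v) (d× (dMember $₁ v) (dCounterexample $₂ (v , v)))))

        -- As in Scott's trick, the value is the stage and not its index: different indices may give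
        -- the same stage, whereas the least stage is unique.
        Least : U → U → Set
        Least p s = (Σ U λ x → s ≡ stage x) × Meets p s × (∀ y → Meets p (stage y) → s ⊑ stage y)

        Least-unique : ∀ p s s' → Least p s → Least p s' → s ≡ s'
        Least-unique p _ _ ((x , refl) , m , h) ((x' , refl) , m' , h') =
          set-ext stage-set stage-set (h x' m') (h' x m)

        leastStage : U → U
        -- Parameters without a counterexample in the class contribute nothing to the hull.
        leastStage = the Least (λ _ → ∅)

        dleastStage : DefF leastStage
        dleastStage = dthe Least-unique (mkR₂ (d× (d∃ (d≡ v (dstage ⟨$⟩ v))) (d× (dMeets $₂ (v , v))
          (d∀ (d→ (dMeets $₂ (v , dstage ⟨$⟩ v)) (d⊑ v (dstage ⟨$⟩ v))))))) (F₁ c)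

        leastStage-transitive : ∀ {p y z} → y ∈ leastStage p → z ∈ y → z ∈ leastStage p
        leastStage-transitive {p} {y} {z} y∈ z∈y with em {Σ U (Least p)}
        ... | no n = ⊥-elim (∉∅ (subst (y ∈_) (the-default n) y∈))
        ... | yes (_ , l@((x , refl) , _)) = subst (z ∈_) (sym (the-spec Least-unique l))
          (proj₂ (stage-transitive x) y z (subst (y ∈_) (the-spec Least-unique l) y∈) z∈y)

        leastStage-meets : ∀ {p u} → Member u → Counterexample p u → Meets p (leastStage p)
        leastStage-meets {p} {u} mu cu =
          let (t , tr , u∈t , h) = supported mu
              (x , m , l) = least-stage {Meets p} (mkR (dMeets $₂ (c , v))) (sg u , u , stage-covers tr h u∈t , mu , cu)
          in subst (Meets p) (sym (the-spec Least-unique ((x , refl) , m , l))) m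

    -- A Skolem hull for the quantified subformulas, with least stages in place of chosen witnesses.
    -- As stages are transitive, so is the hull.
    hull : ∀ {n} → Formula n → U → U
    hull (mem i j)   s = ∅
    hull (ur i)      s = ∅
    hull (eq i j)    s = ∅
    hull fls         s = ∅
    hull (φ ⇒ ψ)     s = hull φ s ∪ hull ψ s
    hull (all {n} ψ) s = hull ψ s ∪ ⋃ (img (leastStage ψ) (dleastStage ψ) (tuples n s))

    thull : ∀ {n} (φ : Formula n) {m} {f : Env m → U} → DefT f → DefT (λ ρ → hull φ (f ρ))
    thull (mem i j)   t = c
    thull (ur i)      t = c
    thull (eq i j)    t = c
    thull fls         t = c
    thull (φ ⇒ ψ)     t = t∪ (thull φ t) (thull ψ t)
    thull (all {n} ψ) t = t∪ (thull ψ t) (t⋃ (timg (ttuples n t)))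

    ∪-mono : ∀ {a b a' b'} → a ⊑ a' → b ⊑ b' → a ∪ b ⊑ a' ∪ b'
    ∪-mono i j z h = case to ∈∪ h of λ { (inj₁ k) → from ∈∪ (inj₁ (i z k)) ; (inj₂ k) → from ∈∪ (inj₂ (j z k)) }

    hull-mono : ∀ {n} (φ : Formula n) {s s'} → s ⊑ s' → hull φ s ⊑ hull φ s'
    hull-mono (mem i j)   i⊑ = λ _ h → h
    hull-mono (ur i)      i⊑ = λ _ h → h
    hull-mono (eq i j)    i⊑ = λ _ h → h
    hull-mono fls         i⊑ = λ _ h → h
    hull-mono (φ ⇒ ψ)     i⊑ = ∪-mono (hull-mono φ i⊑) (hull-mono ψ i⊑)
    hull-mono (all {n} ψ) i⊑ = ∪-mono (hull-mono ψ i⊑) λ z h →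
      let (y , y∈ , z∈y) = to ∈⋃ h ; (p , p∈ , e) = to ∈img y∈ in
      from ∈⋃ (y , from ∈img (p , tuples-mono n i⊑ p p∈ , e) , z∈y)

    hull-transitive : ∀ {n} (φ : Formula n) {s y z} → y ∈ hull φ s → z ∈ y → z ∈ hull φ s
    hull-transitive (mem i j) h k = ⊥-elim (∉∅ h)
    hull-transitive (ur i)    h k = ⊥-elim (∉∅ h)
    hull-transitive (eq i j)  h k = ⊥-elim (∉∅ h)
    hull-transitive fls       h k = ⊥-elim (∉∅ h)
    hull-transitive (φ ⇒ ψ)   h k = case to ∈∪ h of λ
      { (inj₁ l) → from ∈∪ (inj₁ (hull-transitive φ l k)) ; (inj₂ l) → from ∈∪ (inj₂ (hull-transitive ψ l k)) }
    hull-transitive (all ψ) {y = y} {z} h k = case to ∈∪ h of λ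
      { (inj₁ l) → from ∈∪ (inj₁ (hull-transitive ψ l k))
      ; (inj₂ l) → let (w , w∈ , y∈w) = to ∈⋃ l ; (p , p∈ , e) = to ∈img w∈ in
          from ∈∪ (inj₂ (from ∈⋃ (w , w∈ , subst (z ∈_) (sym e)
            (leastStage-transitive ψ (subst (y ∈_) e y∈w) k)))) }

    module _ {n} (φ : Formula n) where
      private
        -- A stage may contain sets outside the class, and these are discarded. Since `Member`
        -- passes to elements, transitivity survives the cut.
        G : U → U
        G s = sep Member dMember (s ∪ hull φ s)

        dG : DefF G
        dG = F₁ (set-valued (λ _ → sep-set) (λ _ _ → ∈sep)
          (d× (d∈ v (t∪ v (thull φ v))) (dMember $₁ v)))

        open Iterates (iterate dG t₀) renaming (carrier to 𝕊)

        G-mono : ∀ {x y} → x ⊑ y → G x ⊑ G y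
        G-mono i z h = let (k , m) = to ∈sep h in from ∈sep (∪-mono i (hull-mono φ i) z k , m)

        t₀⊑G : t₀ ⊑ G t₀
        t₀⊑G z h = from ∈sep (from ∈∪ (inj₁ h) , contains h)

        inner : ∀ {s} → s ∈ 𝕊 → ∀ y → y ∈ s → Member y × (∀ z → z ∈ y → z ∈ s)
        inner = induction {P = λ s → ∀ y → y ∈ s → Member y × (∀ z → z ∈ y → z ∈ s)}
          (mkR (d∀ (d→ (d∈ v v) (d× (dMember $₁ v) (d∀ (d→ (d∈ v v) (d∈ v v)))))))
          (λ y h → contains h , λ z k → proj₂ tr₀ y z h k)
          λ s _ ih y h → let (k , m) = to ∈sep h in m , λ z z∈y → from ∈sep
            ( (case to ∈∪ k of λ
                 { (inj₁ l) → from ∈∪ (inj₁ (proj₂ (ih y l) z z∈y))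
                 ; (inj₂ l) → from ∈∪ (inj₂ (hull-transitive φ l z∈y)) })
            , transitive m z∈y )

        t = ⋃ 𝕊

        common : ∀ {m} {ρ : Env m} → (∀ i → ρ i ∈ t) → Σ U λ s → s ∈ 𝕊 × (∀ i → ρ i ∈ s)
        common {zero} h = t₀ , base , λ ()
        common {suc m} {ρ} h with to ∈⋃ (h zero) | common (λ i → h (suc i))
        ... | s , s∈ , k | s' , s'∈ , k' with chain G-mono t₀⊑G s∈ s'∈
        ...   | inj₁ i = s' , s'∈ , λ { zero → i _ k ; (suc j) → k' j }
        ...   | inj₂ i = s , s∈ , λ { zero → k ; (suc j) → i _ (k' j) }

        counterexample : ∀ {m} (ψ : Formula (suc m)) → (∀ s → hull (all ψ) s ⊑ hull φ s) → {ρ : Env m} →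
          (∀ i → ρ i ∈ t) → ¬ (∀ u → Sat M ψ (ext M u ρ)) → Σ U λ u → u ∈ t × ¬ Sat M ψ (ext M u ρ)
        counterexample {m} ψ sub {ρ} h ¬all =
          let (s , s∈ , k) = common h
              (p , p∈ , e) = encode k
              (u , ¬u) = dne (λ none → ¬all λ u → dne λ ¬u → none (u , ¬u))
              -- The first counterexample `u` may use urelements that no stage over `A` reaches;
              -- elementarity applied to the negation replaces it by one in the class.
              (u' , mu' , ¬u') = witness (ψ ⇒ fls) (λ i → proj₁ (inner s∈ (ρ i) (k i))) ¬u
              (w , w∈ , mw , ¬w) = leastStage-meets ψ {p} mu' (λ q → ¬u' (Sat-cong ψ (agree e) q))
          in w ,
             from ∈⋃ (G s , step s∈ , from ∈sep (from ∈∪ (inj₂ (sub s w (from ∈∪ (inj₂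
               (from ∈⋃ (leastStage ψ p , from ∈img (p , p∈ , refl) , w∈)))))) , mw)) ,
             λ q → ¬w (Sat-cong ψ (λ i → sym (agree e i)) q)
          where
          agree : ∀ {p u} → (∀ i → component i p ≡ ρ i) → ∀ i → ext M u (λ i → component i p) i ≡ ext M u ρ i
          agree e zero    = refl
          agree e (suc i) = e i

        -- The premise on hulls stands for `ψ` being a subformula of `φ`: it is all that the descent
        -- through `φ` needs, since it places the counterexamples for `ψ` in `t`.
        reflects : ∀ {m} (ψ : Formula m) → (∀ s → hull ψ s ⊑ hull φ s) → (ρ : Env m) →
                   (∀ i → ρ i ∈ t) → Sat M ψ ρ ⇔ SatRel M t ψ ρ
        reflects (mem i j) sub ρ h = mk⇔ (λ s → s) (λ s → s)
        reflects (ur i)    sub ρ h = mk⇔ (λ s → s) (λ s → s)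
        reflects (eq i j)  sub ρ h = mk⇔ (λ s → s) (λ s → s)
        reflects fls       sub ρ h = mk⇔ (λ s → s) (λ s → s)
        reflects (ψ ⇒ χ)   sub ρ h = mk⇔ (λ s p → to eχ (s (from eψ p))) (λ s p → from eχ (s (to eψ p)))
          where
          eψ = reflects ψ (λ s z k → sub s z (from ∈∪ (inj₁ k))) ρ h
          eχ = reflects χ (λ s z k → sub s z (from ∈∪ (inj₂ k))) ρ h
        reflects (all ψ)   sub ρ h = mk⇔
            (λ s u u∈t → to (eψ u u∈t) (s u))
            (λ s → dne λ ¬all → let (u , u∈t , ¬u) = counterexample ψ sub h ¬all in ¬u (from (eψ u u∈t) (s u u∈t)))
          where
          eψ : ∀ u → u ∈ t → Sat M ψ (ext M u ρ) ⇔ SatRel M t ψ (ext M u ρ)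
          eψ u u∈t = reflects ψ (λ s z k → sub s z (from ∈∪ (inj₁ k))) (ext M u ρ) λ { zero → u∈t ; (suc i) → h i }

      reflection : Σ U λ t → Transitive M t × t₀ ⊑ t ×
                   (∀ (ρ : Env n) → (∀ i → ρ i ∈ t) → Sat M φ ρ ⇔ SatRel M t φ ρ)
      reflection = t ,
        (⋃-set , λ y z y∈ z∈y → let (s , s∈ , k) = to ∈⋃ y∈ in from ∈⋃ (s , s∈ , proj₂ (inner s∈ y k) z z∈y)) ,
        (λ z h → from ∈⋃ (t₀ , base , h)) ,
        reflects φ (λ _ _ h → h)

  tail⁺⇒reflection : TailPlus M → RP M
  tail⁺⇒reflection tailPlus φ x _ =
    let (t₀ , tr₀ , x⊑t₀) = transitive-superset x
        (t , tr , t₀⊑t , h) = reflection tr₀ (elementary-class tailPlus tr₀) φ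
    in t , tr , (λ z k → t₀⊑t z (x⊑t₀ z k)) , h

theorem2p22 : ExcludedMiddle 0ℓ → (M : Structure) → ZFUR M →
    (TailPlus M → RP M) × (PlenitudePlus M → Duplication M)
theorem2p22 em M zfu = tail⁺⇒reflection , plenitude⁺⇒duplication
  where open SetTheory em M zfu
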